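{- For every integer $n\ge 0$, \[ \binom{2n}{n}^3 =[(xyz)^{2n}]\,(1+xy+xz-yz)^{2n}(1+xy-xz+yz)^{2n}(1-xy+xz+yz)^{2n}. \]
   Context: Here $x,y,z$ are indeterminates, and $[(xyz)^{2n}]$ denotes the coefficient of the monomial $x^{2n}y^{2n}z^{2n}$ in the polynomial that follows. -}

module Defs where

open import Algebra.Bundles.Raw using (RawRing)
import Algebra.Definitions.RawSemiring as RawSemiringDefinitions
open import Data.Bool.Base using (if_then_else_)
open import Data.Fin.Base using (Fin; zero; suc)
open import Data.Integer.Base as ℤ using (ℤ; 0ℤ; 1ℤ)
open import Data.List.Base using (List; []; _∷_; _++_; map; cartesianProductWith)
open import Data.Nat.Base as ℕ using (ℕ)
import Data.Nat.Properties as ℕₚ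
open import Data.Product.Base using (_×_; _,_; map₁)
open import Data.Vec.Base using (Vec; replicate; zipWith; _[_]≔_)
open import Data.Vec.Properties using (≡-dec)
open import Level using (0ℓ)
open import Relation.Binary.PropositionalEquality.Core using (_≡_)
open import Relation.Nullary.Decidable.Core using (does)

-- The vector e stands for the monomial x₀^e₀ ⋯ xₖ₋₁^eₖ₋₁.
Monomial : ℕ → Set
Monomial k = Vec ℕ k

Term : ℕ → Set
Term k = ℤ × Monomial k

-- An element of ℤ[x₀,…,xₖ₋₁], written as a finite sum of terms.  A monomial
-- may occur several times (or with coefficient 0), so equality of polynomials
-- is not _≡_ but equality of all coefficients, see polynomialRawRing.
Polynomial : ℕ → Set
Polynomial k = List (Term k)

coefficient : ∀ {k} → Monomial k → Polynomial k → ℤ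
coefficient e []            = 0ℤ
coefficient e ((c , d) ∷ p) =
  if does (≡-dec ℕₚ._≟_ d e) then c ℤ.+ coefficient e p else coefficient e p

mulTerm : ∀ {k} → Term k → Term k → Term k
mulTerm (c , d) (c′ , d′) = c ℤ.* c′ , zipWith ℕ._+_ d d′

polynomialRawRing : ℕ → RawRing 0ℓ 0ℓ
polynomialRawRing k = record
  { Carrier = Polynomial k
  ; _≈_     = λ p q → ∀ e → coefficient e p ≡ coefficient e q
  ; _+_     = _++_
  ; _*_     = cartesianProductWith mulTerm
  ; -_      = map (map₁ λ c → ℤ.- c)
  ; 0#      = []
  ; 1#      = (1ℤ , replicate k 0) ∷ []
  }

indeterminate : ∀ {k} → Fin k → Polynomial k
indeterminate {k} i = (1ℤ , replicate k 0 [ i ]≔ 1) ∷ []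

ℤ[x,y,z] : RawRing 0ℓ 0ℓ
ℤ[x,y,z] = polynomialRawRing 3

open RawRing ℤ[x,y,z] public using (_+_; _*_; -_; 1#)
open RawSemiringDefinitions (RawRing.rawSemiring ℤ[x,y,z]) public using (_^_)

infixl 6 _-_
_-_ : Polynomial 3 → Polynomial 3 → Polynomial 3
p - q = p + (- q)

x y z : Polynomial 3
x = indeterminate zero
y = indeterminate (suc zero)
z = indeterminate (suc (suc zero))

-- The coefficient of the monomial xᵐyᵐzᵐ in p.
infix 5 [⟨xyz⟩^_]_
[⟨xyz⟩^_]_ : ℕ → Polynomial 3 → ℤ
[⟨xyz⟩^ m ] p = coefficient (replicate 3 m) p

{-# OPTIONS --safe #-}
module Submission where

-- Put N = 2n and group the three factors as s₊ + t₋, s₊ - t₋ and s₋ + t₊, where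
--   s₊ = 1 + xy,  s₋ = 1 - xy,  t₊ = (x + y)z,  t₋ = (x - y)z.
-- Their N-th powers multiply to (s₊² - t₋²)ᴺ (s₋ + t₊)ᴺ.  Expand both powers.
-- The term with (-t₋²)ʲ contributes to zᴺ only through s₋²ʲ t₊ᴺ⁻²ʲ, so the
-- coefficient sought is
--   Σⱼ C(N,j) C(N,2j) (-1)ʲ [xᴺyᴺ] s₊²⁽ᴺ⁻ʲ⁾ s₋²ʲ (x + y)²⁽ⁿ⁻ʲ⁾ (x - y)²ʲ.
--
-- The two kinds of factors separate.  A polynomial in xy sees only the middle
-- coefficient of the form (x + y)²ᵖ (x - y)²ʲ (coefficient-superCatalan).  By
-- (x - y)² = (x + y)² - 4xy, that middle coefficient satisfies the recurrence
-- of the signed super Catalan numbers (-1)ʲ (2p)! (2j)! / (p! j! (p+j)!), whence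
-- C(N,2j) times it is (-1)ʲ C(N,n) C(n,j) (binomial-superCatalan).  So one factor
-- C(N,n) comes out, and with c = xy it remains to show
--   Σⱼ C(N,j) C(n,j) [cⁿ] (1 + c)²⁽ᴺ⁻ʲ⁾ (1 - c)²ʲ = C(N,n)².
--
-- Substituting (1 - c)² = (1 + c)² - 4c turns the left side into
--   Σᵢ (-4)ⁱ C(N,i) C(N-i+n,n-i) C(2N-2i,n-i)
-- (binomialSum-transfer).  By factorials (binomial-product) the summand is
-- C(N,n) C(n,i) (-4)ⁱ gₙ₋ᵢ, where gₖ is the coefficient of tᵏ in
-- (1 - 4t)^(-n-1/2).  Since (-4)ⁱ C(n,i) is the coefficient of tⁱ in (1 - 4t)ⁿ,
-- the sum is C(N,n) times the coefficient of tⁿ in (1 - 4t)^(-1/2), which is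
-- C(N,n) again (binomialSum-halfPower, binomialSum-evaluation).
--
-- To compute with polynomials given as lists of terms, they are made to act on
-- functions of monomials.  Polynomials with the same action form a commutative
-- ring, and the coefficients of a polynomial can be read off from its action.

open import Algebra.Bundles using (CommutativeRing)
open import Algebra.Bundles.Raw using (RawRing)
import Algebra.Properties.CommutativeSemiring.Exp as Exp
import Algebra.Properties.Ring as RingProperties
import Algebra.Solver.Ring.NaturalCoefficients.Default as SemiringSolver
open import Algebra.Structures using (IsCommutativeRing)
open import Data.Bool.Base using (if_then_else_; true; false)
open import Data.Empty using (⊥-elim)
open import Data.Integer.Base as ℤ using (ℤ; +_; 0ℤ; 1ℤ; -1ℤ)
import Data.Integer.Properties as ℤₚ
open import Data.Integer.Tactic.RingSolver using (solve-∀)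
open import Data.List.Base using ([]; _∷_; _++_; map)
open import Data.List.Relation.Unary.All as All using (All; []; _∷_)
import Data.List.Relation.Unary.All.Properties as Allₚ
open import Data.Nat.Base as ℕ using (ℕ; zero; suc; _∸_; _!) renaming (_*_ to _*ℕ_; _^_ to _^ℕ_)
open import Data.Nat.Combinatorics
  using (_C_; nCk≡n!/k![n-k]!; k![n∸k]!∣n!; k>n⇒nCk≡0; nCk+nC[k+1]≡[n+1]C[k+1]; nCk≡nC[n∸k])
open import Data.Nat.DivMod using (m/n*n≡m)
import Data.Nat.Properties as ℕₚ
open import Data.Product.Base using (_,_; proj₂)
open import Data.Sum.Base using (inj₁; inj₂)
open import Data.Vec.Base using ([]; _∷_; replicate; zipWith)
open import Data.Vec.Properties
  using (≡-dec; zipWith-assoc; zipWith-comm; zipWith-identityˡ; zipWith-identityʳ)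
open import Level using (0ℓ)
open import Relation.Binary.PropositionalEquality hiding (setoid)
import Relation.Binary.Reasoning.Setoid as SetoidReasoning
open import Relation.Nullary using (does; yes; no)

-- Integer identities between binomial coefficients

module Arithmetic where

  open import Data.Integer.Base using (-_; _+_; _-_; _*_; _^_; NonZero)
  open import Data.Nat.Base using (_≤_; _<_; s≤s; z≤n)
  open ≡-Reasoning

  -- Factorials and binomial coefficients

  binom : ℕ → ℕ → ℤ
  binom n k = + (n C k)

  binomial-pascal : ∀ n k → binom (suc n) (suc k) ≡ binom n k + binom n (suc k)
  binomial-pascal n k = cong +_ (sym (nCk+nC[k+1]≡[n+1]C[k+1] n k))

  fact : ℕ → ℤ
  fact n = + (n !)

  factorial-suc : ∀ n → fact (suc n) ≡ (1ℤ + + n) * fact n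
  factorial-suc n = ℤₚ.pos-* (suc n) (n !)

  factorial-double-suc : ∀ n → fact (2 ℕ.* suc n) ≡
    (+ 2 + + 2 * + n) * ((1ℤ + + 2 * + n) * fact (2 ℕ.* n))
  factorial-double-suc n = begin
    fact (2 ℕ.* suc n) ≡⟨ cong fact (ℕₚ.*-suc 2 n) ⟩
    fact (2 ℕ.+ 2 ℕ.* n) ≡⟨ factorial-suc (suc (2 ℕ.* n)) ⟩
    (+ 2 + + (2 ℕ.* n)) * fact (suc (2 ℕ.* n))
      ≡⟨ cong ((+ 2 + + (2 ℕ.* n)) *_) (factorial-suc (2 ℕ.* n)) ⟩
    (+ 2 + + (2 ℕ.* n)) * ((1ℤ + + (2 ℕ.* n)) * fact (2 ℕ.* n))
      ≡⟨ cong (λ t → (+ 2 + t) * ((1ℤ + t) * fact (2 ℕ.* n))) (ℤₚ.pos-* 2 n) ⟩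
    (+ 2 + + 2 * + n) * ((1ℤ + + 2 * + n) * fact (2 ℕ.* n)) ∎

  binomial-factorial : ∀ a b → binom (a ℕ.+ b) a * (fact a * fact b) ≡ fact (a ℕ.+ b)
  binomial-factorial a b = begin
    binom (a ℕ.+ b) a * (fact a * fact b) ≡⟨ cong (binom (a ℕ.+ b) a *_) (ℤₚ.pos-* (a !) (b !)) ⟨
    binom (a ℕ.+ b) a * + (a ! ℕ.* b !) ≡⟨ ℤₚ.pos-* ((a ℕ.+ b) C a) (a ! ℕ.* b !) ⟨
    + (((a ℕ.+ b) C a) ℕ.* (a ! ℕ.* b !)) ≡⟨ cong +_ lemma ⟩
    fact (a ℕ.+ b) ∎
    where
    a≤a+b = ℕₚ.m≤m+n a b
    lemma : ((a ℕ.+ b) C a) ℕ.* (a ! ℕ.* b !) ≡ (a ℕ.+ b) !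
    lemma = begin
      ((a ℕ.+ b) C a) ℕ.* (a ! ℕ.* b !)
        ≡⟨ cong (λ t → ((a ℕ.+ b) C a) ℕ.* (a ! ℕ.* t !)) (ℕₚ.m+n∸m≡n a b) ⟨
      ((a ℕ.+ b) C a) ℕ.* (a ! ℕ.* (a ℕ.+ b ∸ a) !)
        ≡⟨ cong (ℕ._* (a ! ℕ.* (a ℕ.+ b ∸ a) !)) (nCk≡n!/k![n-k]! a≤a+b) ⟩
      _ ≡⟨ m/n*n≡m {{a ℕₚ.!* (a ℕ.+ b ∸ a) !≢0}} (k![n∸k]!∣n! a≤a+b) ⟩
      (a ℕ.+ b) ! ∎

  2*n≡n+n : ∀ n → 2 ℕ.* n ≡ n ℕ.+ n
  2*n≡n+n n = cong (n ℕ.+_) (ℕₚ.+-identityʳ n)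

  central-binomial-factorial : ∀ n → binom (2 ℕ.* n) n * (fact n * fact n) ≡ fact (2 ℕ.* n)
  central-binomial-factorial n = begin
    binom (2 ℕ.* n) n * (fact n * fact n) ≡⟨ cong (λ t → binom t n * (fact n * fact n)) (2*n≡n+n n) ⟩
    binom (n ℕ.+ n) n * (fact n * fact n) ≡⟨ binomial-factorial n n ⟩
    fact (n ℕ.+ n) ≡⟨ cong fact (2*n≡n+n n) ⟨
    fact (2 ℕ.* n) ∎

  -- Super Catalan numbers and half-integral powers of 1 - 4t

  -- The signed super Catalan number (-1)^q (2p)! (2q)! / (p! q! (p+q)!), defined
  -- by the recurrence that comes from (x - y)² = (x + y)² - 4xy.  It is the
  -- coefficient of xᵖ⁺ᵠ yᵖ⁺ᵠ in (x + y)²ᵖ (x - y)²ᵠ.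
  superCatalan : ℕ → ℕ → ℤ
  superCatalan p zero    = binom (2 ℕ.* p) p
  superCatalan p (suc q) = superCatalan (suc p) q - + 4 * superCatalan p q

  -- The induction step multiplies by p + 1 so that the case (p + 1, q) applies; that
  -- factor is cancelled at the end.
  superCatalan-factorial : ∀ p q → superCatalan p q * (fact p * (fact q * fact (p ℕ.+ q))) ≡
                  -1ℤ ^ q * (fact (2 ℕ.* p) * fact (2 ℕ.* q))
  superCatalan-factorial p zero = begin
    binom (2 ℕ.* p) p * (fact p * (1ℤ * fact (p ℕ.+ 0)))
      ≡⟨ cong (λ t → binom (2 ℕ.* p) p * (fact p * (1ℤ * fact t))) (ℕₚ.+-identityʳ p) ⟩
    binom (2 ℕ.* p) p * (fact p * (1ℤ * fact p)) ≡⟨ ring₁ (binom (2 ℕ.* p) p) (fact p) ⟩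
    binom (2 ℕ.* p) p * (fact p * fact p) ≡⟨ central-binomial-factorial p ⟩
    fact (2 ℕ.* p) ≡⟨ ring₂ (fact (2 ℕ.* p)) ⟩
    1ℤ * (fact (2 ℕ.* p) * 1ℤ) ∎
    where
    ring₁ : ∀ a b → a * (b * (1ℤ * b)) ≡ a * (b * b)
    ring₁ = solve-∀
    ring₂ : ∀ a → a ≡ 1ℤ * (a * 1ℤ)
    ring₂ = solve-∀
  superCatalan-factorial p (suc q) = ℤₚ.*-cancelˡ-≡ (+ suc p) _ _ (begin
    + suc p * ((superCatalan (suc p) q - + 4 * superCatalan p q) * (fact p * (fact (suc q) * fact (p ℕ.+ suc q))))
      ≡⟨ cong₂ (λ s t → + suc p * ((superCatalan (suc p) q - + 4 * superCatalan p q) * (fact p * (s * t))))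
           (factorial-suc q) (trans (cong fact (ℕₚ.+-suc p q)) (factorial-suc (p ℕ.+ q))) ⟩
    (1ℤ + + p) * ((superCatalan (suc p) q - + 4 * superCatalan p q) *
      (fact p * ((1ℤ + + q) * fact q * ((1ℤ + (+ p + + q)) * fact (p ℕ.+ q)))))
      ≡⟨ ring₁ (+ p) (+ q) (superCatalan (suc p) q) (superCatalan p q) (fact p) (fact q) (fact (p ℕ.+ q)) ⟩
    (1ℤ + + q) * (superCatalan (suc p) q * ((1ℤ + + p) * fact p * (fact q * ((1ℤ + (+ p + + q)) * fact (p ℕ.+ q)))))
    - + 4 * (1ℤ + + p) * (1ℤ + + q) * (1ℤ + (+ p + + q)) * (superCatalan p q * (fact p * (fact q * fact (p ℕ.+ q))))
      ≡⟨ cong₂ (λ s t → (1ℤ + + q) * s - + 4 * (1ℤ + + p) * (1ℤ + + q) * (1ℤ + (+ p + + q)) * t)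
           (trans (cong₂ (λ s t → superCatalan (suc p) q * (s * (fact q * t)))
                    (sym (factorial-suc p)) (sym (factorial-suc (p ℕ.+ q))))
             (trans (superCatalan-factorial (suc p) q) (cong (λ t → -1ℤ ^ q * (t * fact (2 ℕ.* q))) (factorial-double-suc p))))
           (superCatalan-factorial p q) ⟩
    (1ℤ + + q) * (-1ℤ ^ q * ((+ 2 + + 2 * + p) * ((1ℤ + + 2 * + p) * fact (2 ℕ.* p)) * fact (2 ℕ.* q)))
    - + 4 * (1ℤ + + p) * (1ℤ + + q) * (1ℤ + (+ p + + q)) * (-1ℤ ^ q * (fact (2 ℕ.* p) * fact (2 ℕ.* q)))
      ≡⟨ ring₂ (+ p) (+ q) (-1ℤ ^ q) (fact (2 ℕ.* p)) (fact (2 ℕ.* q)) ⟩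
    (1ℤ + + p) * (-1ℤ * -1ℤ ^ q *
      (fact (2 ℕ.* p) * ((+ 2 + + 2 * + q) * ((1ℤ + + 2 * + q) * fact (2 ℕ.* q)))))
      ≡⟨ cong (λ t → (1ℤ + + p) * (-1ℤ * -1ℤ ^ q * (fact (2 ℕ.* p) * t))) (factorial-double-suc q) ⟨
    + suc p * (-1ℤ ^ suc q * (fact (2 ℕ.* p) * fact (2 ℕ.* suc q))) ∎)
    where
    ring₁ : ∀ p q a b u v w →
      (1ℤ + p) * ((a - + 4 * b) * (u * ((1ℤ + q) * v * ((1ℤ + (p + q)) * w)))) ≡
      (1ℤ + q) * (a * ((1ℤ + p) * u * (v * ((1ℤ + (p + q)) * w))))
      - + 4 * (1ℤ + p) * (1ℤ + q) * (1ℤ + (p + q)) * (b * (u * (v * w)))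
    ring₁ = solve-∀
    ring₂ : ∀ p q s u v →
      (1ℤ + q) * (s * ((+ 2 + + 2 * p) * ((1ℤ + + 2 * p) * u) * v))
      - + 4 * (1ℤ + p) * (1ℤ + q) * (1ℤ + (p + q)) * (s * (u * v)) ≡
      (1ℤ + p) * (-1ℤ * s * (u * ((+ 2 + + 2 * q) * ((1ℤ + + 2 * q) * v))))
    ring₂ = solve-∀

  -- halfPower m k is the coefficient of tᵏ in (1 - 4t)^(-m-1/2).  The last clause
  -- is the multiplication by 1 - 4t that leads from m + 1 to m.
  halfPower : ℕ → ℕ → ℤ
  halfPower zero    k       = binom (2 ℕ.* k) k
  halfPower (suc m) zero    = 1ℤ
  halfPower (suc m) (suc k) = halfPower m (suc k) + + 4 * halfPower (suc m) k

  -- The closed form (2m+2k)! m! / (k! (m+k)! (2m)!), cleared of denominators.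
  halfPower-factorial : ∀ m k → halfPower m k * (fact k * (fact (m ℕ.+ k) * fact (2 ℕ.* m))) ≡
                  fact (2 ℕ.* (m ℕ.+ k)) * fact m
  halfPower-factorial zero k = begin
    binom (2 ℕ.* k) k * (fact k * (fact k * 1ℤ)) ≡⟨ ring₁ (binom (2 ℕ.* k) k) (fact k) ⟩
    binom (2 ℕ.* k) k * (fact k * fact k) * 1ℤ ≡⟨ cong (_* 1ℤ) (central-binomial-factorial k) ⟩
    fact (2 ℕ.* k) * 1ℤ ∎
    where
    ring₁ : ∀ a b → a * (b * (b * 1ℤ)) ≡ a * (b * b) * 1ℤ
    ring₁ = solve-∀
  halfPower-factorial (suc m) zero = begin
    1ℤ * (1ℤ * (fact (suc m ℕ.+ 0) * fact (2 ℕ.* suc m)))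
      ≡⟨ cong (λ t → 1ℤ * (1ℤ * (fact t * fact (2 ℕ.* suc m)))) (ℕₚ.+-identityʳ (suc m)) ⟩
    1ℤ * (1ℤ * (fact (suc m) * fact (2 ℕ.* suc m)))
      ≡⟨ ring₁ (fact (suc m)) (fact (2 ℕ.* suc m)) ⟩
    fact (2 ℕ.* suc m) * fact (suc m)
      ≡⟨ cong (λ t → fact (2 ℕ.* t) * fact (suc m)) (ℕₚ.+-identityʳ (suc m)) ⟨
    fact (2 ℕ.* (suc m ℕ.+ 0)) * fact (suc m) ∎
    where
    ring₁ : ∀ a b → 1ℤ * (1ℤ * (a * b)) ≡ b * a
    ring₁ = solve-∀
  halfPower-factorial (suc m) (suc k) = begin
    (halfPower m (suc k) + + 4 * halfPower (suc m) k) * (fact (suc k) * (fact (suc (m ℕ.+ suc k)) * fact (2 ℕ.* suc m)))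
      ≡⟨ cong₂ (λ s t → (halfPower m (suc k) + + 4 * halfPower (suc m) k) * (s * t)) (factorial-suc k)
           (cong₂ _*_ (trans (factorial-suc (m ℕ.+ suc k)) (cong ((1ℤ + (+ m + (1ℤ + + k))) *_) factorial-m+suck)) (factorial-double-suc m)) ⟩
    (halfPower m (suc k) + + 4 * halfPower (suc m) k) * ((1ℤ + + k) * fact k *
      ((1ℤ + (+ m + (1ℤ + + k))) * ((1ℤ + (+ m + + k)) * fact (m ℕ.+ k))
       * ((+ 2 + + 2 * + m) * ((1ℤ + + 2 * + m) * fact (2 ℕ.* m)))))
      ≡⟨ ring₁ (+ m) (+ k) (halfPower m (suc k)) (halfPower (suc m) k) (fact k) (fact (m ℕ.+ k)) (fact (2 ℕ.* m)) ⟩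
    c₁ * (halfPower m (suc k) * ((1ℤ + + k) * fact k * ((1ℤ + (+ m + + k)) * fact (m ℕ.+ k) * fact (2 ℕ.* m))))
    + c₂ * (halfPower (suc m) k * (fact k * ((1ℤ + (+ m + + k)) * fact (m ℕ.+ k)
            * ((+ 2 + + 2 * + m) * ((1ℤ + + 2 * + m) * fact (2 ℕ.* m))))))
      ≡⟨ cong₂ (λ s t → c₁ * s + c₂ * t)
          (trans (cong₂ (λ s t → halfPower m (suc k) * (s * (t * fact (2 ℕ.* m)))) (sym (factorial-suc k)) (sym factorial-m+suck))
            (trans (halfPower-factorial m (suc k)) (cong (λ t → fact (2 ℕ.* t) * fact m) (ℕₚ.+-suc m k))))
          (trans (cong₂ (λ s t → halfPower (suc m) k * (fact k * (s * t))) (sym (factorial-suc (m ℕ.+ k))) (sym (factorial-double-suc m)))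
            (trans (halfPower-factorial (suc m) k) (cong (fact (2 ℕ.* suc (m ℕ.+ k)) *_) (factorial-suc m)))) ⟩
    c₁ * (fact (2 ℕ.* suc (m ℕ.+ k)) * fact m) + c₂ * (fact (2 ℕ.* suc (m ℕ.+ k)) * ((1ℤ + + m) * fact m))
      ≡⟨ ring₂ (+ m) (+ k) (fact (2 ℕ.* suc (m ℕ.+ k))) (fact m) ⟩
    (+ 2 + + 2 * (1ℤ + (+ m + + k))) * ((1ℤ + + 2 * (1ℤ + (+ m + + k))) * fact (2 ℕ.* suc (m ℕ.+ k)))
      * ((1ℤ + + m) * fact m)
      ≡⟨ cong₂ _*_ (trans (sym (factorial-double-suc (suc (m ℕ.+ k)))) (cong (λ t → fact (2 ℕ.* suc t)) (sym (ℕₚ.+-suc m k))))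
           (sym (factorial-suc m)) ⟩
    fact (2 ℕ.* (suc m ℕ.+ suc k)) * fact (suc m) ∎
    where
    c₁ = (1ℤ + (+ m + (1ℤ + + k))) * ((+ 2 + + 2 * + m) * (1ℤ + + 2 * + m))
    c₂ = + 4 * (1ℤ + + k) * (1ℤ + (+ m + (1ℤ + + k)))
    factorial-m+suck : fact (m ℕ.+ suc k) ≡ (1ℤ + (+ m + + k)) * fact (m ℕ.+ k)
    factorial-m+suck = trans (cong fact (ℕₚ.+-suc m k)) (factorial-suc (m ℕ.+ k))
    ring₁ : ∀ m k a b u v w →
      (a + + 4 * b) * ((1ℤ + k) * u *
        ((1ℤ + (m + (1ℤ + k))) * ((1ℤ + (m + k)) * v) * ((+ 2 + + 2 * m) * ((1ℤ + + 2 * m) * w)))) ≡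
      (1ℤ + (m + (1ℤ + k))) * ((+ 2 + + 2 * m) * (1ℤ + + 2 * m))
        * (a * ((1ℤ + k) * u * ((1ℤ + (m + k)) * v * w)))
      + + 4 * (1ℤ + k) * (1ℤ + (m + (1ℤ + k)))
        * (b * (u * ((1ℤ + (m + k)) * v * ((+ 2 + + 2 * m) * ((1ℤ + + 2 * m) * w)))))
    ring₁ = solve-∀
    ring₂ : ∀ m k u v →
      (1ℤ + (m + (1ℤ + k))) * ((+ 2 + + 2 * m) * (1ℤ + + 2 * m)) * (u * v)
      + + 4 * (1ℤ + k) * (1ℤ + (m + (1ℤ + k))) * (u * ((1ℤ + m) * v)) ≡
      (+ 2 + + 2 * (1ℤ + (m + k))) * ((1ℤ + + 2 * (1ℤ + (m + k))) * u) * ((1ℤ + m) * v)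
    ring₂ = solve-∀

  -- Sums weighted by binomial coefficients

  -- binomialSum n f is the sum of C(n,i) f k i over all k + i = n.  The recursion,
  -- in which the binomial coefficients are implicit, makes the binomial theorem an
  -- immediate induction.
  binomialSum : ℕ → (ℕ → ℕ → ℤ) → ℤ
  binomialSum zero    f = f 0 0
  binomialSum (suc n) f = binomialSum n (λ k i → f (suc k) i) + binomialSum n (λ k i → f k (suc i))

  binomialSum-cong : ∀ n {f g} → (∀ k i → k ℕ.+ i ≡ n → f k i ≡ g k i) → binomialSum n f ≡ binomialSum n g
  binomialSum-cong zero    f≡g = f≡g 0 0 refl
  binomialSum-cong (suc n) f≡g = cong₂ _+_
    (binomialSum-cong n λ k i k+i≡n → f≡g (suc k) i (cong suc k+i≡n))
    (binomialSum-cong n λ k i k+i≡n → f≡g k (suc i) (trans (ℕₚ.+-suc k i) (cong suc k+i≡n)))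

  +-interchange : ∀ a b c d → (a + b) + (c + d) ≡ (a + c) + (b + d)
  +-interchange = solve-∀

  binomialSum-+ : ∀ n f g → binomialSum n (λ k i → f k i + g k i) ≡ binomialSum n f + binomialSum n g
  binomialSum-+ zero    f g = refl
  binomialSum-+ (suc n) f g = trans
    (cong₂ _+_ (binomialSum-+ n (λ k i → f (suc k) i) (λ k i → g (suc k) i))
               (binomialSum-+ n (λ k i → f k (suc i)) (λ k i → g k (suc i))))
    (+-interchange (binomialSum n (λ k i → f (suc k) i)) (binomialSum n (λ k i → g (suc k) i))
                   (binomialSum n (λ k i → f k (suc i))) (binomialSum n (λ k i → g k (suc i))))

  binomialSum-*ˡ : ∀ n c f → binomialSum n (λ k i → c * f k i) ≡ c * binomialSum n f
  binomialSum-*ˡ zero    c f = refl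
  binomialSum-*ˡ (suc n) c f = trans
    (cong₂ _+_ (binomialSum-*ˡ n c (λ k i → f (suc k) i)) (binomialSum-*ˡ n c (λ k i → f k (suc i))))
    (sym (ℤₚ.*-distribˡ-+ c (binomialSum n (λ k i → f (suc k) i)) (binomialSum n (λ k i → f k (suc i)))))

  binomialSum-zero : ∀ n {f} → (∀ k i → k ℕ.+ i ≡ n → f k i ≡ 0ℤ) → binomialSum n f ≡ 0ℤ
  binomialSum-zero zero    f≡0 = f≡0 0 0 refl
  binomialSum-zero (suc n) f≡0 = cong₂ _+_
    (binomialSum-zero n λ k i k+i≡n → f≡0 (suc k) i (cong suc k+i≡n))
    (binomialSum-zero n λ k i k+i≡n → f≡0 k (suc i) (trans (ℕₚ.+-suc k i) (cong suc k+i≡n)))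

  -- The sum of f i over i < K.
  sumBelow : ℕ → (ℕ → ℤ) → ℤ
  sumBelow zero    f = 0ℤ
  sumBelow (suc K) f = f 0 + sumBelow K (λ i → f (suc i))

  sumBelow-cong : ∀ K {f g} → (∀ i → f i ≡ g i) → sumBelow K f ≡ sumBelow K g
  sumBelow-cong zero    f≡g = refl
  sumBelow-cong (suc K) f≡g = cong₂ _+_ (f≡g 0) (sumBelow-cong K λ i → f≡g (suc i))

  sumBelow-+ : ∀ K f g → sumBelow K (λ i → f i + g i) ≡ sumBelow K f + sumBelow K g
  sumBelow-+ zero    f g = refl
  sumBelow-+ (suc K) f g = trans
    (cong (λ t → f 0 + g 0 + t) (sumBelow-+ K (λ i → f (suc i)) (λ i → g (suc i))))
    (+-interchange (f 0) (g 0) (sumBelow K (λ i → f (suc i))) (sumBelow K (λ i → g (suc i))))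

  sumBelow-zero : ∀ K {f} → (∀ i → f i ≡ 0ℤ) → sumBelow K f ≡ 0ℤ
  sumBelow-zero zero    f≡0 = refl
  sumBelow-zero (suc K) f≡0 = cong₂ _+_ (f≡0 0) (sumBelow-zero K λ i → f≡0 (suc i))

  binomial-zero : ∀ {n k} → n < k → binom n k ≡ 0ℤ
  binomial-zero n<k = cong +_ (k>n⇒nCk≡0 n<k)

  *-zero-factor : ∀ {a} b → a ≡ 0ℤ → a * b ≡ 0ℤ
  *-zero-factor b refl = ℤₚ.*-zeroˡ b

  -- Any K > n may be chosen, so that two binomial sums of different orders can be
  -- compared term by term.
  binomialSum-explicit : ∀ n K f → n < K → binomialSum n f ≡ sumBelow K (λ i → binom n i * f (n ∸ i) i)
  binomialSum-explicit zero (suc K) f _ = sym (begin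
    1ℤ * f 0 0 + sumBelow K (λ i → binom 0 (suc i) * f 0 (suc i))
      ≡⟨ cong (λ t → 1ℤ * f 0 0 + t) (sumBelow-zero K λ i → *-zero-factor (f 0 (suc i)) (binomial-zero {0} {suc i} (s≤s z≤n))) ⟩
    1ℤ * f 0 0 + 0ℤ ≡⟨ ring₁ (f 0 0) ⟩
    f 0 0 ∎)
    where
    ring₁ : ∀ a → 1ℤ * a + 0ℤ ≡ a
    ring₁ = solve-∀
  binomialSum-explicit (suc n) (suc K) f (s≤s n<K) = begin
    binomialSum n (λ k i → f (suc k) i) + binomialSum n (λ k i → f k (suc i))
      ≡⟨ cong₂ _+_ (binomialSum-explicit n (suc K) (λ k i → f (suc k) i) (ℕₚ.m≤n⇒m≤1+n n<K))
                   (binomialSum-explicit n K (λ k i → f k (suc i)) n<K) ⟩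
    (1ℤ * f (suc n) 0 + sumBelow K (λ i → binom n (suc i) * f (suc (n ∸ suc i)) (suc i)))
      + sumBelow K (λ i → binom n i * f (n ∸ i) (suc i))
      ≡⟨ ℤₚ.+-assoc (1ℤ * f (suc n) 0) _ _ ⟩
    1ℤ * f (suc n) 0 + (sumBelow K (λ i → binom n (suc i) * f (suc (n ∸ suc i)) (suc i))
      + sumBelow K (λ i → binom n i * f (n ∸ i) (suc i)))
      ≡⟨ cong (λ t → 1ℤ * f (suc n) 0 + t) (sym (sumBelow-+ K
           (λ i → binom n (suc i) * f (suc (n ∸ suc i)) (suc i))
           (λ i → binom n i * f (n ∸ i) (suc i)))) ⟩
    1ℤ * f (suc n) 0 + sumBelow K (λ i → binom n (suc i) * f (suc (n ∸ suc i)) (suc i)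
      + binom n i * f (n ∸ i) (suc i))
      ≡⟨ cong (λ t → 1ℤ * f (suc n) 0 + t) (sumBelow-cong K step) ⟩
    1ℤ * f (suc n) 0 + sumBelow K (λ i → binom (suc n) (suc i) * f (n ∸ i) (suc i)) ∎
    where
    ring₁ : ∀ a b c → a * c + b * c ≡ (b + a) * c
    ring₁ = solve-∀
    reindex : ∀ i → binom n (suc i) * f (suc (n ∸ suc i)) (suc i) ≡ binom n (suc i) * f (n ∸ i) (suc i)
    reindex i with ℕₚ.≤-<-connex (suc i) n
    ... | inj₁ i<n = cong (λ t → binom n (suc i) * f t (suc i)) (sym (ℕₚ.+-∸-assoc 1 i<n))
    ... | inj₂ n≤i = trans (*-zero-factor _ (binomial-zero n≤i)) (sym (*-zero-factor _ (binomial-zero n≤i)))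
    step : ∀ i → binom n (suc i) * f (suc (n ∸ suc i)) (suc i) + binom n i * f (n ∸ i) (suc i)
               ≡ binom (suc n) (suc i) * f (n ∸ i) (suc i)
    step i = begin
      binom n (suc i) * f (suc (n ∸ suc i)) (suc i) + binom n i * f (n ∸ i) (suc i)
        ≡⟨ cong (_+ binom n i * f (n ∸ i) (suc i)) (reindex i) ⟩
      binom n (suc i) * f (n ∸ i) (suc i) + binom n i * f (n ∸ i) (suc i)
        ≡⟨ ring₁ (binom n (suc i)) (binom n i) (f (n ∸ i) (suc i)) ⟩
      (binom n i + binom n (suc i)) * f (n ∸ i) (suc i)
        ≡⟨ cong (_* f (n ∸ i) (suc i)) (binomial-pascal n i) ⟨
      binom (suc n) (suc i) * f (n ∸ i) (suc i) ∎

  -- The truncated n ∸ l does no harm for l > n, where the binomial coefficient is 0.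
  binomialSum-single : ∀ n l f → (∀ k i → k ℕ.+ i ≡ n → k ≢ l → f k i ≡ 0ℤ) →
               binomialSum n f ≡ binom n l * f l (n ∸ l)
  binomialSum-single zero    zero    f _   = sym (ℤₚ.*-identityˡ (f 0 0))
  binomialSum-single zero    (suc l) f f≡0 = trans (f≡0 0 0 refl λ ())
    (sym (*-zero-factor (f (suc l) 0) (binomial-zero {0} {suc l} (s≤s z≤n))))
  binomialSum-single (suc n) zero    f f≡0 = begin
    binomialSum n (λ k i → f (suc k) i) + binomialSum n (λ k i → f k (suc i))
      ≡⟨ cong₂ _+_
           (binomialSum-zero n λ k i k+i≡n → f≡0 (suc k) i (cong suc k+i≡n) λ ())
           (binomialSum-single n 0 (λ k i → f k (suc i)) λ k i k+i≡n →
              f≡0 k (suc i) (trans (ℕₚ.+-suc k i) (cong suc k+i≡n))) ⟩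
    0ℤ + 1ℤ * f 0 (suc n) ≡⟨ ℤₚ.+-identityˡ _ ⟩
    1ℤ * f 0 (suc n) ∎
  binomialSum-single (suc n) (suc l) f f≡0 = begin
    binomialSum n (λ k i → f (suc k) i) + binomialSum n (λ k i → f k (suc i))
      ≡⟨ cong₂ _+_
           (binomialSum-single n l (λ k i → f (suc k) i) λ k i k+i≡n k≢l →
              f≡0 (suc k) i (cong suc k+i≡n) λ eq → k≢l (ℕₚ.suc-injective eq))
           (binomialSum-single n (suc l) (λ k i → f k (suc i)) λ k i k+i≡n →
              f≡0 k (suc i) (trans (ℕₚ.+-suc k i) (cong suc k+i≡n))) ⟩
    binom n l * f (suc l) (n ∸ l) + binom n (suc l) * f (suc l) (suc (n ∸ suc l))
      ≡⟨ cong (λ t → binom n l * f (suc l) (n ∸ l) + t) reindex ⟩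
    binom n l * f (suc l) (n ∸ l) + binom n (suc l) * f (suc l) (n ∸ l)
      ≡⟨ ℤₚ.*-distribʳ-+ (f (suc l) (n ∸ l)) (binom n l) (binom n (suc l)) ⟨
    (binom n l + binom n (suc l)) * f (suc l) (n ∸ l)
      ≡⟨ cong (_* f (suc l) (n ∸ l)) (binomial-pascal n l) ⟨
    binom (suc n) (suc l) * f (suc l) (n ∸ l) ∎
    where
    reindex : binom n (suc l) * f (suc l) (suc (n ∸ suc l)) ≡ binom n (suc l) * f (suc l) (n ∸ l)
    reindex with ℕₚ.≤-<-connex (suc l) n
    ... | inj₁ l<n = cong (λ t → binom n (suc l) * f (suc l) t) (sym (ℕₚ.+-∸-assoc 1 l<n))
    ... | inj₂ n≤l = trans (*-zero-factor _ (binomial-zero n≤l)) (sym (*-zero-factor _ (binomial-zero n≤l)))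

  -- The substitution Y = X + w in a binomial sum

  -- shifted n m j is the coefficient of sᵐ in sʲ (1 + s)ⁿ, that is,
  -- C(n,m-j) for j ≤ m and 0 for j > m.
  shifted : ℕ → ℕ → ℕ → ℤ
  shifted n m       zero    = binom n m
  shifted n zero    (suc j) = 0ℤ
  shifted n (suc m) (suc j) = shifted n m j

  shiftedBinomial-≤ : ∀ n {m j} → j ≤ m → shifted n m j ≡ binom n (m ∸ j)
  shiftedBinomial-≤ n z≤n       = refl
  shiftedBinomial-≤ n (s≤s j≤m) = shiftedBinomial-≤ n j≤m

  shiftedBinomial-> : ∀ n {m j} → m < j → shifted n m j ≡ 0ℤ
  shiftedBinomial-> n {zero}  (s≤s z≤n) = refl
  shiftedBinomial-> n {suc m} (s≤s m<j) = shiftedBinomial-> n m<j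

  shiftedBinomial-zero : ∀ n j → shifted (suc n) 0 j ≡ shifted n 0 j
  shiftedBinomial-zero n zero    = refl
  shiftedBinomial-zero n (suc j) = refl

  shiftedBinomial-pascal : ∀ n m j → shifted (suc n) (suc m) j ≡ shifted n m j + shifted n (suc m) j
  shiftedBinomial-pascal n m       zero    = binomial-pascal n m
  shiftedBinomial-pascal n zero    (suc j) = trans (shiftedBinomial-zero n j) (sym (ℤₚ.+-identityˡ (shifted n 0 j)))
  shiftedBinomial-pascal n (suc m) (suc j) = shiftedBinomial-pascal n m j

  shiftedBinomial-diagonal : ∀ n j → shifted n n j ≡ binom n j
  shiftedBinomial-diagonal n j with ℕₚ.≤-<-connex j n
  ... | inj₁ j≤n = trans (shiftedBinomial-≤ n j≤n) (cong +_ (sym (nCk≡nC[n∸k] j≤n)))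
  ... | inj₂ n<j = trans (shiftedBinomial-> n n<j) (sym (binomial-zero n<j))

  -- T k j i stands for λ(Xᵏ Yʲ wⁱ), where λ is a linear functional and Y = X + w.
  -- The lemma applies λ to the coefficient of sᵐ in
  -- (X + sY)ᴺ (1 + s)ⁿ = (X(1 + s) + sw)ᴺ (1 + s)ⁿ, expanded in both ways.
  binomialSum-transfer : ∀ N n m (T : ℕ → ℕ → ℕ → ℤ) →
    (∀ k j i → T k (suc j) i ≡ T (suc k) j i + T k j (suc i)) →
    binomialSum N (λ k j → shifted n m j * T k j 0) ≡ binomialSum N (λ k i → shifted (k ℕ.+ n) m i * T k 0 i)
  binomialSum-transfer zero    n m T rec = refl
  binomialSum-transfer (suc N) n zero T rec = cong₂ _+_
    (begin
      binomialSum N (λ k j → shifted n 0 j * T (suc k) j 0)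
        ≡⟨ binomialSum-transfer N n 0 (λ k → T (suc k)) (λ k → rec (suc k)) ⟩
      binomialSum N (λ k i → shifted (k ℕ.+ n) 0 i * T (suc k) 0 i)
        ≡⟨ binomialSum-cong N (λ k i _ → cong (_* T (suc k) 0 i) (sym (shiftedBinomial-zero (k ℕ.+ n) i))) ⟩
      binomialSum N (λ k i → shifted (suc k ℕ.+ n) 0 i * T (suc k) 0 i) ∎)
    (binomialSum-cong N (λ k i _ → trans (ℤₚ.*-zeroˡ (T k (suc i) 0)) (sym (ℤₚ.*-zeroˡ (T k 0 (suc i))))))
  binomialSum-transfer (suc N) n (suc m) T rec = begin
    binomialSum N (λ k j → shifted n (suc m) j * T (suc k) j 0) + binomialSum N (λ k j → shifted n m j * T k (suc j) 0)
      ≡⟨ sym (binomialSum-+ N (λ k j → shifted n (suc m) j * T (suc k) j 0) (λ k j → shifted n m j * T k (suc j) 0)) ⟩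
    binomialSum N (λ k j → shifted n (suc m) j * T (suc k) j 0 + shifted n m j * T k (suc j) 0)
      ≡⟨ binomialSum-cong N (λ k j _ → pascal k j) ⟩
    binomialSum N (λ k j → shifted (suc n) (suc m) j * T (suc k) j 0 + shifted n m j * T k j 1)
      ≡⟨ binomialSum-+ N (λ k j → shifted (suc n) (suc m) j * T (suc k) j 0) (λ k j → shifted n m j * T k j 1) ⟩
    binomialSum N (λ k j → shifted (suc n) (suc m) j * T (suc k) j 0) + binomialSum N (λ k j → shifted n m j * T k j 1)
      ≡⟨ cong₂ _+_ (binomialSum-transfer N (suc n) (suc m) (λ k → T (suc k)) (λ k → rec (suc k)))
                   (binomialSum-transfer N n m (λ k j i → T k j (suc i)) (λ k j i → rec k j (suc i))) ⟩
    binomialSum N (λ k i → shifted (k ℕ.+ suc n) (suc m) i * T (suc k) 0 i)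
      + binomialSum N (λ k i → shifted (k ℕ.+ n) m i * T k 0 (suc i))
      ≡⟨ cong (_+ binomialSum N (λ k i → shifted (k ℕ.+ n) m i * T k 0 (suc i)))
           (binomialSum-cong N λ k i _ → cong (λ t → shifted t (suc m) i * T (suc k) 0 i) (ℕₚ.+-suc k n)) ⟩
    binomialSum N (λ k i → shifted (suc k ℕ.+ n) (suc m) i * T (suc k) 0 i)
      + binomialSum N (λ k i → shifted (k ℕ.+ n) m i * T k 0 (suc i)) ∎
    where
    ring₁ : ∀ a b c d → a * c + b * (c + d) ≡ (b + a) * c + b * d
    ring₁ = solve-∀
    pascal : ∀ k j → shifted n (suc m) j * T (suc k) j 0 + shifted n m j * T k (suc j) 0
                   ≡ shifted (suc n) (suc m) j * T (suc k) j 0 + shifted n m j * T k j 1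
    pascal k j = begin
      shifted n (suc m) j * T (suc k) j 0 + shifted n m j * T k (suc j) 0
        ≡⟨ cong (λ t → shifted n (suc m) j * T (suc k) j 0 + shifted n m j * t) (rec k j 0) ⟩
      shifted n (suc m) j * T (suc k) j 0 + shifted n m j * (T (suc k) j 0 + T k j 1)
        ≡⟨ ring₁ (shifted n (suc m) j) (shifted n m j) (T (suc k) j 0) (T k j 1) ⟩
      (shifted n m j + shifted n (suc m) j) * T (suc k) j 0 + shifted n m j * T k j 1
        ≡⟨ cong (λ t → t * T (suc k) j 0 + shifted n m j * T k j 1) (shiftedBinomial-pascal n m j) ⟨
      shifted (suc n) (suc m) j * T (suc k) j 0 + shifted n m j * T k j 1 ∎

  -- Evaluation of the remaining sum

  -4ℤ : ℤ
  -4ℤ = - + 4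

  -- Multiplication by (1 - 4t)ᵃ, which lowers the index a + m to m, seen on the
  -- coefficient of tᵃ⁺ᵇ.
  binomialSum-halfPower : ∀ a b m → binomialSum a (λ k i → -4ℤ ^ i * halfPower (a ℕ.+ m) (k ℕ.+ b)) ≡ halfPower m (a ℕ.+ b)
  binomialSum-halfPower zero    b m = ℤₚ.*-identityˡ (halfPower m b)
  binomialSum-halfPower (suc a) b m = begin
    binomialSum a (λ k i → -4ℤ ^ i * halfPower (suc a ℕ.+ m) (suc k ℕ.+ b))
      + binomialSum a (λ k i → -4ℤ ^ suc i * halfPower (suc a ℕ.+ m) (k ℕ.+ b))
      ≡⟨ binomialSum-+ a (λ k i → -4ℤ ^ i * halfPower (suc a ℕ.+ m) (suc k ℕ.+ b))
                 (λ k i → -4ℤ ^ suc i * halfPower (suc a ℕ.+ m) (k ℕ.+ b)) ⟨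
    binomialSum a (λ k i → -4ℤ ^ i * halfPower (suc a ℕ.+ m) (suc k ℕ.+ b)
                 + -4ℤ ^ suc i * halfPower (suc a ℕ.+ m) (k ℕ.+ b))
      ≡⟨ binomialSum-cong a (λ k i _ → trans
           (ring₁ (-4ℤ ^ i) (halfPower (a ℕ.+ m) (suc k ℕ.+ b)) (halfPower (suc a ℕ.+ m) (k ℕ.+ b)))
           (cong (λ t → -4ℤ ^ i * halfPower (a ℕ.+ m) t) (sym (ℕₚ.+-suc k b)))) ⟩
    binomialSum a (λ k i → -4ℤ ^ i * halfPower (a ℕ.+ m) (k ℕ.+ suc b))
      ≡⟨ binomialSum-halfPower a (suc b) m ⟩
    halfPower m (a ℕ.+ suc b)
      ≡⟨ cong (halfPower m) (ℕₚ.+-suc a b) ⟩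
    halfPower m (suc a ℕ.+ b) ∎
    where
    ring₁ : ∀ s u v → s * (u + + 4 * v) + (- + 4) * s * v ≡ s * u
    ring₁ = solve-∀

  -- Both sides are (2n+2k)! / (i! (n+k)! k! k!).
  binomial-product : ∀ i k → let n = i ℕ.+ k in
    binom (2 ℕ.* n) i * (binom (k ℕ.+ 2 ℕ.* n) k * binom (2 ℕ.* (n ℕ.+ k)) k) ≡
    binom n i * (binom (2 ℕ.* n) n * halfPower n k)
  binomial-product i k = ℤₚ.*-cancelʳ-≡ _ _ D {{D-nonZero}} (begin
    c₁ * (c₂ * c₃) * D
      ≡⟨ ring₁ c₁ c₂ c₃ (fact i) (fact (n ℕ.+ k)) (fact k) (fact (2 ℕ.* n)) (fact (k ℕ.+ 2 ℕ.* n)) ⟩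
    (c₁ * (fact i * fact (n ℕ.+ k))) * (c₂ * (fact k * fact (2 ℕ.* n))) * (c₃ * (fact k * fact (k ℕ.+ 2 ℕ.* n)))
      ≡⟨ cong₂ _*_ (cong₂ _*_ h₁ (binomial-factorial k (2 ℕ.* n))) h₃ ⟩
    fact (2 ℕ.* n) * fact (k ℕ.+ 2 ℕ.* n) * fact (2 ℕ.* (n ℕ.+ k))
      ≡⟨ cong (λ t → t * fact (k ℕ.+ 2 ℕ.* n) * fact (2 ℕ.* (n ℕ.+ k))) (central-binomial-factorial n) ⟨
    d₂ * (fact n * fact n) * fact (k ℕ.+ 2 ℕ.* n) * fact (2 ℕ.* (n ℕ.+ k))
      ≡⟨ ring₂ d₂ (fact n) (fact (k ℕ.+ 2 ℕ.* n)) (fact (2 ℕ.* (n ℕ.+ k))) ⟩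
    fact n * d₂ * (fact (2 ℕ.* (n ℕ.+ k)) * fact n) * fact (k ℕ.+ 2 ℕ.* n)
      ≡⟨ cong₂ (λ s t → s * d₂ * t * fact (k ℕ.+ 2 ℕ.* n)) (sym (binomial-factorial i k)) (sym (halfPower-factorial n k)) ⟩
    binom n i * (fact i * fact k) * d₂ * (halfPower n k * (fact k * (fact (n ℕ.+ k) * fact (2 ℕ.* n)))) * fact (k ℕ.+ 2 ℕ.* n)
      ≡⟨ ring₃ (binom n i) d₂ (halfPower n k) (fact i) (fact (n ℕ.+ k)) (fact k) (fact (2 ℕ.* n)) (fact (k ℕ.+ 2 ℕ.* n)) ⟩
    binom n i * (d₂ * halfPower n k) * D ∎)
    where
    n = i ℕ.+ k
    c₁ = binom (2 ℕ.* n) i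
    c₂ = binom (k ℕ.+ 2 ℕ.* n) k
    c₃ = binom (2 ℕ.* (n ℕ.+ k)) k
    d₂ = binom (2 ℕ.* n) n
    D = fact i * fact (n ℕ.+ k) * (fact k * fact k) * (fact (2 ℕ.* n) * fact (k ℕ.+ 2 ℕ.* n))
    factorial≢0 : ∀ {m} → NonZero (fact m)
    factorial≢0 {m} = m ℕₚ.!≢0
    D-nonZero : NonZero D
    D-nonZero = ℤₚ.i*j≢0 (fact i * fact (n ℕ.+ k) * (fact k * fact k)) (fact (2 ℕ.* n) * fact (k ℕ.+ 2 ℕ.* n))
      {{ℤₚ.i*j≢0 (fact i * fact (n ℕ.+ k)) (fact k * fact k)
         {{ℤₚ.i*j≢0 (fact i) (fact (n ℕ.+ k)) {{factorial≢0 {i}}} {{factorial≢0 {n ℕ.+ k}}}}}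
         {{ℤₚ.i*j≢0 (fact k) (fact k) {{factorial≢0 {k}}} {{factorial≢0 {k}}}}}}}
      {{ℤₚ.i*j≢0 (fact (2 ℕ.* n)) (fact (k ℕ.+ 2 ℕ.* n)) {{factorial≢0 {2 ℕ.* n}}} {{factorial≢0 {k ℕ.+ 2 ℕ.* n}}}}}
    2n≡ : i ℕ.+ (n ℕ.+ k) ≡ 2 ℕ.* n
    2n≡ = begin
      i ℕ.+ (n ℕ.+ k) ≡⟨ cong (i ℕ.+_) (ℕₚ.+-comm n k) ⟩
      i ℕ.+ (k ℕ.+ n) ≡⟨ ℕₚ.+-assoc i k n ⟨
      n ℕ.+ n ≡⟨ 2*n≡n+n n ⟨
      2 ℕ.* n ∎
    2n+2k≡ : k ℕ.+ (k ℕ.+ 2 ℕ.* n) ≡ 2 ℕ.* (n ℕ.+ k)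
    2n+2k≡ = begin
      k ℕ.+ (k ℕ.+ 2 ℕ.* n) ≡⟨ ℕₚ.+-assoc k k (2 ℕ.* n) ⟨
      k ℕ.+ k ℕ.+ 2 ℕ.* n ≡⟨ cong (ℕ._+ 2 ℕ.* n) (2*n≡n+n k) ⟨
      2 ℕ.* k ℕ.+ 2 ℕ.* n ≡⟨ ℕₚ.+-comm (2 ℕ.* k) (2 ℕ.* n) ⟩
      2 ℕ.* n ℕ.+ 2 ℕ.* k ≡⟨ ℕₚ.*-distribˡ-+ 2 n k ⟨
      2 ℕ.* (n ℕ.+ k) ∎
    h₁ : c₁ * (fact i * fact (n ℕ.+ k)) ≡ fact (2 ℕ.* n)
    h₁ = subst (λ t → binom t i * (fact i * fact (n ℕ.+ k)) ≡ fact t) 2n≡ (binomial-factorial i (n ℕ.+ k))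
    h₃ : c₃ * (fact k * fact (k ℕ.+ 2 ℕ.* n)) ≡ fact (2 ℕ.* (n ℕ.+ k))
    h₃ = subst (λ t → binom t k * (fact k * fact (k ℕ.+ 2 ℕ.* n)) ≡ fact t) 2n+2k≡ (binomial-factorial k (k ℕ.+ 2 ℕ.* n))
    ring₁ : ∀ c₁ c₂ c₃ u v w s t → c₁ * (c₂ * c₃) * (u * v * (w * w) * (s * t)) ≡
           (c₁ * (u * v)) * (c₂ * (w * s)) * (c₃ * (w * t))
    ring₁ = solve-∀
    ring₂ : ∀ d u v w → d * (u * u) * v * w ≡ u * d * (w * u) * v
    ring₂ = solve-∀
    ring₃ : ∀ d₁ d₂ g u v w s t → d₁ * (u * w) * d₂ * (g * (w * (v * s))) * t ≡
           d₁ * (d₂ * g) * (u * v * (w * w) * (s * t))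
    ring₃ = solve-∀

  -- The two binomial sums have orders 2n and n.  They agree term by term, because
  -- the terms with i > n of the first one vanish.
  binomialSum-evaluation : ∀ n → binomialSum (2 ℕ.* n) (λ k i → shifted (k ℕ.+ n) n i * (-4ℤ ^ i * shifted (2 ℕ.* k) n i)) ≡
                binom (2 ℕ.* n) n * binom (2 ℕ.* n) n
  binomialSum-evaluation n = begin
    binomialSum (2 ℕ.* n) f
      ≡⟨ binomialSum-explicit (2 ℕ.* n) K f ℕₚ.≤-refl ⟩
    sumBelow K (λ i → binom (2 ℕ.* n) i * f (2 ℕ.* n ∸ i) i)
      ≡⟨ sumBelow-cong K termwise ⟩
    sumBelow K (λ i → binom n i * g (n ∸ i) i)
      ≡⟨ binomialSum-explicit n K g (s≤s (ℕₚ.m≤n*m n 2)) ⟨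
    binomialSum n (λ k i → binom (2 ℕ.* n) n * (-4ℤ ^ i * halfPower (n ℕ.+ 0) (k ℕ.+ 0)))
      ≡⟨ binomialSum-*ˡ n (binom (2 ℕ.* n) n) (λ k i → -4ℤ ^ i * halfPower (n ℕ.+ 0) (k ℕ.+ 0)) ⟩
    binom (2 ℕ.* n) n * binomialSum n (λ k i → -4ℤ ^ i * halfPower (n ℕ.+ 0) (k ℕ.+ 0))
      ≡⟨ cong (binom (2 ℕ.* n) n *_) (binomialSum-halfPower n 0 0) ⟩
    binom (2 ℕ.* n) n * halfPower 0 (n ℕ.+ 0)
      ≡⟨ cong (λ t → binom (2 ℕ.* n) n * halfPower 0 t) (ℕₚ.+-identityʳ n) ⟩
    binom (2 ℕ.* n) n * binom (2 ℕ.* n) n ∎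
    where
    K = suc (2 ℕ.* n)
    f g : ℕ → ℕ → ℤ
    f k i = shifted (k ℕ.+ n) n i * (-4ℤ ^ i * shifted (2 ℕ.* k) n i)
    g k i = binom (2 ℕ.* n) n * (-4ℤ ^ i * halfPower (n ℕ.+ 0) (k ℕ.+ 0))
    ring₁ : ∀ a b s c → a * (b * (s * c)) ≡ s * (a * (b * c))
    ring₁ = solve-∀
    ring₂ : ∀ a b s c → s * (a * (b * c)) ≡ a * (b * (s * c))
    ring₂ = solve-∀
    small : ∀ i k → i ℕ.+ k ≡ n → binom (2 ℕ.* n) i * f (2 ℕ.* n ∸ i) i ≡ binom n i * g k i
    small i k refl = begin
      binom (2 ℕ.* n) i * f (2 ℕ.* n ∸ i) i
        ≡⟨ cong (λ t → binom (2 ℕ.* n) i * f t i) index ⟩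
      binom (2 ℕ.* n) i * (shifted (n ℕ.+ k ℕ.+ n) n i * (-4ℤ ^ i * shifted (2 ℕ.* (n ℕ.+ k)) n i))
        ≡⟨ cong₂ (λ s t → binom (2 ℕ.* n) i * (s * (-4ℤ ^ i * t)))
             (trans (unshift (n ℕ.+ k ℕ.+ n)) (cong (λ t → binom t k) index′)) (unshift (2 ℕ.* (n ℕ.+ k))) ⟩
      binom (2 ℕ.* n) i * (binom (k ℕ.+ 2 ℕ.* n) k * (-4ℤ ^ i * binom (2 ℕ.* (n ℕ.+ k)) k))
        ≡⟨ ring₁ (binom (2 ℕ.* n) i) (binom (k ℕ.+ 2 ℕ.* n) k) (-4ℤ ^ i) (binom (2 ℕ.* (n ℕ.+ k)) k) ⟩
      -4ℤ ^ i * (binom (2 ℕ.* n) i * (binom (k ℕ.+ 2 ℕ.* n) k * binom (2 ℕ.* (n ℕ.+ k)) k))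
        ≡⟨ cong (-4ℤ ^ i *_) (binomial-product i k) ⟩
      -4ℤ ^ i * (binom n i * (binom (2 ℕ.* n) n * halfPower n k))
        ≡⟨ ring₂ (binom n i) (binom (2 ℕ.* n) n) (-4ℤ ^ i) (halfPower n k) ⟩
      binom n i * (binom (2 ℕ.* n) n * (-4ℤ ^ i * halfPower n k))
        ≡⟨ cong₂ (λ s t → binom n i * (binom (2 ℕ.* n) n * (-4ℤ ^ i * halfPower s t)))
             (sym (ℕₚ.+-identityʳ n)) (sym (ℕₚ.+-identityʳ k)) ⟩
      binom n i * g k i ∎
      where
      index : 2 ℕ.* n ∸ i ≡ n ℕ.+ k
      index = begin
        2 ℕ.* n ∸ i ≡⟨ cong (_∸ i) (2*n≡n+n n) ⟩
        (i ℕ.+ k ℕ.+ n) ∸ i ≡⟨ cong (_∸ i) (ℕₚ.+-assoc i k n) ⟩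
        (i ℕ.+ (k ℕ.+ n)) ∸ i ≡⟨ ℕₚ.m+n∸m≡n i (k ℕ.+ n) ⟩
        k ℕ.+ n ≡⟨ ℕₚ.+-comm k n ⟩
        n ℕ.+ k ∎
      index′ : n ℕ.+ k ℕ.+ n ≡ k ℕ.+ 2 ℕ.* n
      index′ = begin
        n ℕ.+ k ℕ.+ n ≡⟨ cong (ℕ._+ n) (ℕₚ.+-comm n k) ⟩
        k ℕ.+ n ℕ.+ n ≡⟨ ℕₚ.+-assoc k n n ⟩
        k ℕ.+ (n ℕ.+ n) ≡⟨ cong (k ℕ.+_) (2*n≡n+n n) ⟨
        k ℕ.+ 2 ℕ.* n ∎
      unshift : ∀ N → shifted N n i ≡ binom N k
      unshift N = trans (shiftedBinomial-≤ N (ℕₚ.m≤m+n i k)) (cong (binom N) (ℕₚ.m+n∸m≡n i k))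
    termwise : ∀ i → binom (2 ℕ.* n) i * f (2 ℕ.* n ∸ i) i ≡ binom n i * g (n ∸ i) i
    termwise i with ℕₚ.≤-<-connex i n
    ... | inj₁ i≤n = small i (n ∸ i) (ℕₚ.m+[n∸m]≡n i≤n)
    ... | inj₂ n<i = begin
      binom (2 ℕ.* n) i * f (2 ℕ.* n ∸ i) i
        ≡⟨ cong (binom (2 ℕ.* n) i *_) (*-zero-factor _ (shiftedBinomial-> (2 ℕ.* n ∸ i ℕ.+ n) n<i)) ⟩
      binom (2 ℕ.* n) i * 0ℤ ≡⟨ ℤₚ.*-zeroʳ (binom (2 ℕ.* n) i) ⟩
      0ℤ ≡⟨ *-zero-factor (g (n ∸ i) i) (binomial-zero n<i) ⟨
      binom n i * g (n ∸ i) i ∎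

open Arithmetic

-- The ring of polynomials

open import Defs

module _ {k : ℕ} where

  open ≡-Reasoning
  private
    open module RR = RawRing (polynomialRawRing k) using () renaming (_*_ to _∙_; -_ to neg; 1# to one)

  infixl 6 _⊕_
  _⊕_ : Monomial k → Monomial k → Monomial k
  _⊕_ = zipWith ℕ._+_

  ⊕-assoc : ∀ a b c → (a ⊕ b) ⊕ c ≡ a ⊕ (b ⊕ c)
  ⊕-assoc = zipWith-assoc ℕₚ.+-assoc

  ⊕-comm : ∀ a b → a ⊕ b ≡ b ⊕ a
  ⊕-comm = zipWith-comm ℕₚ.+-comm

  infixr 7 _▷_
  -- The action of a polynomial on functions of monomials that is adjoint to
  -- multiplication: the term c·xᵈ sends g to the function m ↦ c · g (m + d).
  _▷_ : Polynomial k → (Monomial k → ℤ) → Monomial k → ℤ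
  ([]            ▷ g) m = 0ℤ
  (((c , d) ∷ p) ▷ g) m = c ℤ.* g (m ⊕ d) ℤ.+ (p ▷ g) m

  ▷-cong : ∀ p {g h} → (∀ m → g m ≡ h m) → ∀ m → (p ▷ g) m ≡ (p ▷ h) m
  ▷-cong []            g≡h m = refl
  ▷-cong ((c , d) ∷ p) g≡h m = cong₂ (λ s t → c ℤ.* s ℤ.+ t) (g≡h (m ⊕ d)) (▷-cong p g≡h m)

  ▷-zero : ∀ p m → (p ▷ λ _ → 0ℤ) m ≡ 0ℤ
  ▷-zero []            m = refl
  ▷-zero ((c , d) ∷ p) m = cong₂ ℤ._+_ (ℤₚ.*-zeroʳ c) (▷-zero p m)

  ▷-plus : ∀ p g h m → (p ▷ λ d → g d ℤ.+ h d) m ≡ (p ▷ g) m ℤ.+ (p ▷ h) m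
  ▷-plus []            g h m = refl
  ▷-plus ((c , d) ∷ p) g h m = begin
    c ℤ.* (g (m ⊕ d) ℤ.+ h (m ⊕ d)) ℤ.+ (p ▷ λ d → g d ℤ.+ h d) m
      ≡⟨ cong₂ ℤ._+_ (ℤₚ.*-distribˡ-+ c (g (m ⊕ d)) (h (m ⊕ d))) (▷-plus p g h m) ⟩
    (c ℤ.* g (m ⊕ d) ℤ.+ c ℤ.* h (m ⊕ d)) ℤ.+ ((p ▷ g) m ℤ.+ (p ▷ h) m)
      ≡⟨ +-interchange (c ℤ.* g (m ⊕ d)) (c ℤ.* h (m ⊕ d)) ((p ▷ g) m) ((p ▷ h) m) ⟩
    (c ℤ.* g (m ⊕ d) ℤ.+ (p ▷ g) m) ℤ.+ (c ℤ.* h (m ⊕ d) ℤ.+ (p ▷ h) m) ∎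

  ▷-scale : ∀ p a d g m → (p ▷ λ e → a ℤ.* g (e ⊕ d)) m ≡ a ℤ.* (p ▷ g) (m ⊕ d)
  ▷-scale []             a d g m = sym (ℤₚ.*-zeroʳ a)
  ▷-scale ((c , d′) ∷ p) a d g m = begin
    c ℤ.* (a ℤ.* g ((m ⊕ d′) ⊕ d)) ℤ.+ (p ▷ λ e → a ℤ.* g (e ⊕ d)) m
      ≡⟨ cong₂ (λ s t → c ℤ.* (a ℤ.* g s) ℤ.+ t) swap (▷-scale p a d g m) ⟩
    c ℤ.* (a ℤ.* g ((m ⊕ d) ⊕ d′)) ℤ.+ a ℤ.* (p ▷ g) (m ⊕ d)
      ≡⟨ ring₁ c a (g ((m ⊕ d) ⊕ d′)) ((p ▷ g) (m ⊕ d)) ⟩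
    a ℤ.* (c ℤ.* g ((m ⊕ d) ⊕ d′) ℤ.+ (p ▷ g) (m ⊕ d)) ∎
    where
    ring₁ : ∀ c a u v → c ℤ.* (a ℤ.* u) ℤ.+ a ℤ.* v ≡ a ℤ.* (c ℤ.* u ℤ.+ v)
    ring₁ = solve-∀
    swap : (m ⊕ d′) ⊕ d ≡ (m ⊕ d) ⊕ d′
    swap = trans (⊕-assoc m d′ d) (trans (cong (m ⊕_) (⊕-comm d′ d)) (sym (⊕-assoc m d d′)))

  ++-▷ : ∀ p q g m → ((p ++ q) ▷ g) m ≡ (p ▷ g) m ℤ.+ (q ▷ g) m
  ++-▷ []            q g m = sym (ℤₚ.+-identityˡ ((q ▷ g) m))
  ++-▷ ((c , d) ∷ p) q g m = trans (cong (λ t → c ℤ.* g (m ⊕ d) ℤ.+ t) (++-▷ p q g m))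
    (sym (ℤₚ.+-assoc (c ℤ.* g (m ⊕ d)) ((p ▷ g) m) ((q ▷ g) m)))

  neg-▷ : ∀ p g m → (neg p ▷ g) m ≡ ℤ.- (p ▷ g) m
  neg-▷ []            g m = refl
  neg-▷ ((c , d) ∷ p) g m = trans (cong (λ t → ℤ.- c ℤ.* g (m ⊕ d) ℤ.+ t) (neg-▷ p g m))
    (ring₁ c (g (m ⊕ d)) ((p ▷ g) m))
    where
    ring₁ : ∀ c u v → ℤ.- c ℤ.* u ℤ.+ ℤ.- v ≡ ℤ.- (c ℤ.* u ℤ.+ v)
    ring₁ = solve-∀

  mulTerm-▷ : ∀ c d q g m → (map (mulTerm (c , d)) q ▷ g) m ≡ c ℤ.* (q ▷ g) (m ⊕ d)
  mulTerm-▷ c d []             g m = sym (ℤₚ.*-zeroʳ c)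
  mulTerm-▷ c d ((c′ , d′) ∷ q) g m = begin
    c ℤ.* c′ ℤ.* g (m ⊕ (d ⊕ d′)) ℤ.+ (map (mulTerm (c , d)) q ▷ g) m
      ≡⟨ cong₂ (λ s t → c ℤ.* c′ ℤ.* g s ℤ.+ t) (sym (⊕-assoc m d d′)) (mulTerm-▷ c d q g m) ⟩
    c ℤ.* c′ ℤ.* g ((m ⊕ d) ⊕ d′) ℤ.+ c ℤ.* (q ▷ g) (m ⊕ d)
      ≡⟨ ring₁ c c′ (g ((m ⊕ d) ⊕ d′)) ((q ▷ g) (m ⊕ d)) ⟩
    c ℤ.* (c′ ℤ.* g ((m ⊕ d) ⊕ d′) ℤ.+ (q ▷ g) (m ⊕ d)) ∎
    where
    ring₁ : ∀ c c′ u v → c ℤ.* c′ ℤ.* u ℤ.+ c ℤ.* v ≡ c ℤ.* (c′ ℤ.* u ℤ.+ v)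
    ring₁ = solve-∀

  *-▷ : ∀ p q g m → ((p ∙ q) ▷ g) m ≡ (p ▷ (q ▷ g)) m
  *-▷ []            q g m = refl
  *-▷ ((c , d) ∷ p) q g m = begin
    ((map (mulTerm (c , d)) q ++ p ∙ q) ▷ g) m
      ≡⟨ ++-▷ (map (mulTerm (c , d)) q) (p ∙ q) g m ⟩
    (map (mulTerm (c , d)) q ▷ g) m ℤ.+ ((p ∙ q) ▷ g) m
      ≡⟨ cong₂ ℤ._+_ (mulTerm-▷ c d q g m) (*-▷ p q g m) ⟩
    c ℤ.* (q ▷ g) (m ⊕ d) ℤ.+ (p ▷ (q ▷ g)) m ∎

  ▷-swap : ∀ p q g m → (p ▷ (q ▷ g)) m ≡ (q ▷ (p ▷ g)) m
  ▷-swap []            q g m = sym (▷-zero q m)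
  ▷-swap ((c , d) ∷ p) q g m = begin
    c ℤ.* (q ▷ g) (m ⊕ d) ℤ.+ (p ▷ (q ▷ g)) m
      ≡⟨ cong₂ ℤ._+_ (sym (▷-scale q c d g m)) (▷-swap p q g m) ⟩
    (q ▷ λ e → c ℤ.* g (e ⊕ d)) m ℤ.+ (q ▷ (p ▷ g)) m
      ≡⟨ ▷-plus q (λ e → c ℤ.* g (e ⊕ d)) (p ▷ g) m ⟨
    (q ▷ (((c , d) ∷ p) ▷ g)) m ∎

  one-▷ : ∀ g m → (one ▷ g) m ≡ g m
  one-▷ g m = begin
    1ℤ ℤ.* g (m ⊕ replicate k 0) ℤ.+ 0ℤ ≡⟨ ring₁ (g (m ⊕ replicate k 0)) ⟩
    g (m ⊕ replicate k 0) ≡⟨ cong g (zipWith-identityʳ ℕₚ.+-identityʳ m) ⟩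
    g m ∎
    where
    ring₁ : ∀ u → 1ℤ ℤ.* u ℤ.+ 0ℤ ≡ u
    ring₁ = solve-∀

  -- Polynomials are identified when they act in the same way.  This implies that
  -- their coefficients are equal (coefficient-cong), and it makes the ring laws,
  -- including the congruence of multiplication, follow from those of the action.
  infix 4 _≋_
  record _≋_ (p q : Polynomial k) : Set where
    constructor acts
    field act : ∀ g m → (p ▷ g) m ≡ (q ▷ g) m
  open _≋_ public

  ≋-isCommutativeRing : IsCommutativeRing _≋_ _++_ _∙_ neg [] one
  ≋-isCommutativeRing = record
    { isRing = record
      { +-isAbelianGroup = record
        { isGroup = record
          { isMonoid = record
            { isSemigroup = record
              { isMagma = record
                { isEquivalence = record
                  { refl  = acts λ g m → refl
                  ; sym   = λ p≋q → acts λ g m → sym (act p≋q g m)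
                  ; trans = λ p≋q q≋r → acts λ g m → trans (act p≋q g m) (act q≋r g m)
                  }
                ; ∙-cong = λ {p} {p′} {q} {q′} p≋p′ q≋q′ → acts λ g m → begin
                    ((p ++ q) ▷ g) m ≡⟨ ++-▷ p q g m ⟩
                    (p ▷ g) m ℤ.+ (q ▷ g) m ≡⟨ cong₂ ℤ._+_ (act p≋p′ g m) (act q≋q′ g m) ⟩
                    (p′ ▷ g) m ℤ.+ (q′ ▷ g) m ≡⟨ ++-▷ p′ q′ g m ⟨
                    ((p′ ++ q′) ▷ g) m ∎
                }
              ; assoc = λ p q r → acts λ g m → begin
                  (((p ++ q) ++ r) ▷ g) m ≡⟨ ++-▷ (p ++ q) r g m ⟩
                  ((p ++ q) ▷ g) m ℤ.+ (r ▷ g) m ≡⟨ cong (ℤ._+ (r ▷ g) m) (++-▷ p q g m) ⟩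
                  (p ▷ g) m ℤ.+ (q ▷ g) m ℤ.+ (r ▷ g) m
                    ≡⟨ ℤₚ.+-assoc ((p ▷ g) m) ((q ▷ g) m) ((r ▷ g) m) ⟩
                  (p ▷ g) m ℤ.+ ((q ▷ g) m ℤ.+ (r ▷ g) m)
                    ≡⟨ cong (λ t → (p ▷ g) m ℤ.+ t) (++-▷ q r g m) ⟨
                  (p ▷ g) m ℤ.+ ((q ++ r) ▷ g) m ≡⟨ ++-▷ p (q ++ r) g m ⟨
                  ((p ++ (q ++ r)) ▷ g) m ∎
              }
            ; identity = (λ p → acts λ g m → refl)
                       , (λ p → acts λ g m → trans (++-▷ p [] g m) (ℤₚ.+-identityʳ ((p ▷ g) m)))
            }
          ; inverse = (λ p → acts λ g m → trans (++-▷ (neg p) p g m)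
                        (trans (cong (ℤ._+ (p ▷ g) m) (neg-▷ p g m)) (ℤₚ.+-inverseˡ ((p ▷ g) m))))
                    , (λ p → acts λ g m → trans (++-▷ p (neg p) g m)
                        (trans (cong (λ t → (p ▷ g) m ℤ.+ t) (neg-▷ p g m)) (ℤₚ.+-inverseʳ ((p ▷ g) m))))
          ; ⁻¹-cong = λ {p} {q} p≋q → acts λ g m →
              trans (neg-▷ p g m) (trans (cong ℤ.-_ (act p≋q g m)) (sym (neg-▷ q g m)))
          }
        ; comm = λ p q → acts λ g m → trans (++-▷ p q g m)
            (trans (ℤₚ.+-comm ((p ▷ g) m) ((q ▷ g) m)) (sym (++-▷ q p g m)))
        }
      ; *-cong = λ {p} {p′} {q} {q′} p≋p′ q≋q′ → acts λ g m → begin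
          ((p ∙ q) ▷ g) m ≡⟨ *-▷ p q g m ⟩
          (p ▷ (q ▷ g)) m ≡⟨ ▷-cong p (act q≋q′ g) m ⟩
          (p ▷ (q′ ▷ g)) m ≡⟨ act p≋p′ (q′ ▷ g) m ⟩
          (p′ ▷ (q′ ▷ g)) m ≡⟨ *-▷ p′ q′ g m ⟨
          ((p′ ∙ q′) ▷ g) m ∎
      ; *-assoc = λ p q r → acts λ g m → begin
          (((p ∙ q) ∙ r) ▷ g) m ≡⟨ *-▷ (p ∙ q) r g m ⟩
          ((p ∙ q) ▷ (r ▷ g)) m ≡⟨ *-▷ p q (r ▷ g) m ⟩
          (p ▷ (q ▷ (r ▷ g))) m ≡⟨ ▷-cong p (*-▷ q r g) m ⟨
          (p ▷ ((q ∙ r) ▷ g)) m ≡⟨ *-▷ p (q ∙ r) g m ⟨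
          ((p ∙ (q ∙ r)) ▷ g) m ∎
      ; *-identity = (λ p → acts λ g m → trans (*-▷ one p g m) (one-▷ (p ▷ g) m))
                   , (λ p → acts λ g m → trans (*-▷ p one g m) (▷-cong p (one-▷ g) m))
      ; distrib = (λ p q r → acts λ g m → begin
            ((p ∙ (q ++ r)) ▷ g) m ≡⟨ *-▷ p (q ++ r) g m ⟩
            (p ▷ ((q ++ r) ▷ g)) m ≡⟨ ▷-cong p (++-▷ q r g) m ⟩
            (p ▷ λ d → (q ▷ g) d ℤ.+ (r ▷ g) d) m ≡⟨ ▷-plus p (q ▷ g) (r ▷ g) m ⟩
            (p ▷ (q ▷ g)) m ℤ.+ (p ▷ (r ▷ g)) m ≡⟨ cong₂ ℤ._+_ (*-▷ p q g m) (*-▷ p r g m) ⟨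
            ((p ∙ q) ▷ g) m ℤ.+ ((p ∙ r) ▷ g) m ≡⟨ ++-▷ (p ∙ q) (p ∙ r) g m ⟨
            ((p ∙ q ++ p ∙ r) ▷ g) m ∎)
        , (λ p q r → acts λ g m → begin
            (((q ++ r) ∙ p) ▷ g) m ≡⟨ *-▷ (q ++ r) p g m ⟩
            ((q ++ r) ▷ (p ▷ g)) m ≡⟨ ++-▷ q r (p ▷ g) m ⟩
            (q ▷ (p ▷ g)) m ℤ.+ (r ▷ (p ▷ g)) m ≡⟨ cong₂ ℤ._+_ (*-▷ q p g m) (*-▷ r p g m) ⟨
            ((q ∙ p) ▷ g) m ℤ.+ ((r ∙ p) ▷ g) m ≡⟨ ++-▷ (q ∙ p) (r ∙ p) g m ⟨
            ((q ∙ p ++ r ∙ p) ▷ g) m ∎)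
      }
    ; *-comm = λ p q → acts λ g m → trans (*-▷ p q g m) (trans (▷-swap p q g m) (sym (*-▷ q p g m)))
    }

  -- The function with value 1 at e and 0 elsewhere.  Acting on it and evaluating at
  -- the monomial 1 extracts the coefficient of e.
  indicator : Monomial k → Monomial k → ℤ
  indicator e d = if does (≡-dec ℕₚ._≟_ d e) then 1ℤ else 0ℤ

  coefficient-▷ : ∀ e p → coefficient e p ≡ (p ▷ indicator e) (replicate k 0)
  coefficient-▷ e []            = refl
  coefficient-▷ e ((c , d) ∷ p) =
    trans lemma (cong (λ t → c ℤ.* indicator e t ℤ.+ (p ▷ indicator e) (replicate k 0))
      (sym (zipWith-identityˡ ℕₚ.+-identityˡ d)))
    where
    lemma : coefficient e ((c , d) ∷ p) ≡ c ℤ.* indicator e d ℤ.+ (p ▷ indicator e) (replicate k 0)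
    lemma with does (≡-dec ℕₚ._≟_ d e)
    ... | true  = cong₂ ℤ._+_ (sym (ℤₚ.*-identityʳ c)) (coefficient-▷ e p)
    ... | false = trans (coefficient-▷ e p) (trans (sym (ℤₚ.+-identityˡ _))
                    (cong (ℤ._+ (p ▷ indicator e) (replicate k 0)) (sym (ℤₚ.*-zeroʳ c))))

  coefficient-cong : ∀ e {p q} → p ≋ q → coefficient e p ≡ coefficient e q
  coefficient-cong e {p} {q} p≋q = trans (coefficient-▷ e p)
    (trans (act p≋q (indicator e) (replicate k 0)) (sym (coefficient-▷ e q)))

  coefficient-+ : ∀ e p q → coefficient e (p ++ q) ≡ coefficient e p ℤ.+ coefficient e q
  coefficient-+ e p q = trans (coefficient-▷ e (p ++ q)) (trans (++-▷ p q (indicator e) (replicate k 0))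
    (cong₂ ℤ._+_ (sym (coefficient-▷ e p)) (sym (coefficient-▷ e q))))

  coefficient-neg : ∀ e p → coefficient e (neg p) ≡ ℤ.- coefficient e p
  coefficient-neg e p = trans (coefficient-▷ e (neg p)) (trans (neg-▷ p (indicator e) (replicate k 0))
    (cong ℤ.-_ (sym (coefficient-▷ e p))))

-- The polynomials in k indeterminates as a commutative ring, with the operations
-- of polynomialRawRing k and with _≋_ as equality.
polynomialRing : ℕ → CommutativeRing 0ℓ 0ℓ
polynomialRing k = record { isCommutativeRing = ≋-isCommutativeRing {k} }

open CommutativeRing (polynomialRing 3)
  using ( ring; commutativeSemiring; setoid; +-cong; +-congˡ; +-congʳ; +-assoc; +-identityʳ
        ; *-cong; *-congˡ; *-congʳ; *-assoc; *-comm; *-identityˡ; -‿inverseˡ; -‿inverseʳ; distribʳ)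
  renaming (refl to ≋-refl; sym to ≋-sym; trans to ≋-trans)
open RingProperties ring using (-‿distribˡ-*)
open SemiringSolver commutativeSemiring using (solve; _:+_; _:*_; _:=_)
module ≋-Reasoning = SetoidReasoning setoid
private module ^′ = Exp commutativeSemiring

-- Powers and the binomial theorem for polynomials

-- The powers formed in the raw ring and in polynomialRing 3 are given by the same
-- recursion, but they are not convertible at a variable exponent, because the two
-- ring structures carry different equalities.
^-≡ : ∀ p n → p ^ n ≡ p ^′.^ n
^-≡ p zero    = refl
^-≡ p (suc n) = cong (p *_) (^-≡ p n)

^-congˡ : ∀ n {p q} → p ≋ q → p ^ n ≋ q ^ n
^-congˡ n {p} {q} p≋q rewrite ^-≡ p n | ^-≡ q n = ^′.^-congˡ n p≋q

^-homo-* : ∀ p m n → p ^ (m ℕ.+ n) ≋ p ^ m * p ^ n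
^-homo-* p m n rewrite ^-≡ p (m ℕ.+ n) | ^-≡ p m | ^-≡ p n = ^′.^-homo-* p m n

^-distrib-* : ∀ p q n → (p * q) ^ n ≋ p ^ n * q ^ n
^-distrib-* p q n rewrite ^-≡ (p * q) n | ^-≡ p n | ^-≡ q n = ^′.^-distrib-* p q n

square-^ : ∀ p n → (p * p) ^ n ≋ p ^ (2 *ℕ n)
square-^ p n = ≋-trans (^-distrib-* p p n) (≋-trans (≋-sym (^-homo-* p n n))
  (subst (λ t → p ^ (n ℕ.+ n) ≋ p ^ t) (sym (2*n≡n+n n)) ≋-refl))

p-q+q≋p : ∀ p q → (p - q) + q ≋ p
p-q+q≋p p q = ≋-trans (+-assoc p (- q) q) (≋-trans (+-congˡ (-‿inverseˡ q)) (+-identityʳ p))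

difference-of-squares : ∀ p q → (p + q) * (p - q) ≋ p * p - q * q
difference-of-squares p q = begin
  (p + q) * d ≈⟨ +-identityʳ _ ⟨
  (p + q) * d + [] ≈⟨ +-congˡ (-‿inverseʳ (q * q)) ⟨
  (p + q) * d + (q * q + - (q * q)) ≈⟨ +-assoc ((p + q) * d) (q * q) (- (q * q)) ⟨
  ((p + q) * d + q * q) - q * q ≈⟨ +-congʳ (+-congʳ (*-congʳ (+-congʳ d+q))) ⟨
  (((d + q) + q) * d + q * q) - q * q
    ≈⟨ +-congʳ (solve 2 (λ d q → ((d :+ q) :+ q) :* d :+ q :* q := (d :+ q) :* (d :+ q)) ≋-refl d q) ⟩
  (d + q) * (d + q) - q * q ≈⟨ +-congʳ (*-cong d+q d+q) ⟩
  p * p - q * q ∎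
  where
  open ≋-Reasoning
  d = p - q
  d+q = p-q+q≋p p q

square-of-difference : ∀ p q → (p - q) * (p - q) + ((p * q + p * q) + (p * q + p * q)) ≋ (p + q) * (p + q)
square-of-difference p q = begin
  d * d + ((p * q + p * q) + (p * q + p * q))
    ≈⟨ +-congˡ {d * d} (+-cong (+-cong pq pq) (+-cong pq pq)) ⟩
  d * d + (((d + q) * q + (d + q) * q) + ((d + q) * q + (d + q) * q))
    ≈⟨ solve 2 (λ d q → d :* d :+ (((d :+ q) :* q :+ (d :+ q) :* q) :+ ((d :+ q) :* q :+ (d :+ q) :* q))
                        := ((d :+ q) :+ q) :* ((d :+ q) :+ q)) ≋-refl d q ⟩
  ((d + q) + q) * ((d + q) + q)
    ≈⟨ *-cong (+-congʳ d+q) (+-congʳ d+q) ⟩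
  (p + q) * (p + q) ∎
  where
  open ≋-Reasoning
  d = p - q
  d+q = p-q+q≋p p q
  pq : p * q ≋ (d + q) * q
  pq = *-congʳ (≋-sym d+q)

-- The rule (p - q)² = (p + q)² - 4pq, which drives both recurrences.
coefficient-square-of-difference : ∀ e p q r →
  coefficient e ((p - q) * (p - q) * r) ≡
  coefficient e ((p + q) * (p + q) * r) ℤ.+ -4ℤ ℤ.* coefficient e (p * q * r)
coefficient-square-of-difference e p q r = begin
  coefficient e ((p - q) * (p - q) * r)
    ≡⟨ ring₁ (coefficient e ((p - q) * (p - q) * r)) c ⟩
  (coefficient e ((p - q) * (p - q) * r) ℤ.+ ((c ℤ.+ c) ℤ.+ (c ℤ.+ c))) ℤ.+ -4ℤ ℤ.* c
    ≡⟨ cong (ℤ._+ -4ℤ ℤ.* c) sum ⟨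
  coefficient e ((p + q) * (p + q) * r) ℤ.+ -4ℤ ℤ.* c ∎
  where
  open ≡-Reasoning
  c = coefficient e (p * q * r)
  ring₁ : ∀ u c → u ≡ (u ℤ.+ ((c ℤ.+ c) ℤ.+ (c ℤ.+ c))) ℤ.+ (ℤ.- + 4) ℤ.* c
  ring₁ = solve-∀
  two : ∀ s t → coefficient e ((s + t) * r) ≡ coefficient e (s * r) ℤ.+ coefficient e (t * r)
  two s t = trans (coefficient-cong e (distribʳ r s t)) (coefficient-+ e (s * r) (t * r))
  sum : coefficient e ((p + q) * (p + q) * r) ≡
        coefficient e ((p - q) * (p - q) * r) ℤ.+ ((c ℤ.+ c) ℤ.+ (c ℤ.+ c))
  sum = begin
    coefficient e ((p + q) * (p + q) * r)
      ≡⟨ coefficient-cong e (*-congʳ (≋-sym (square-of-difference p q))) ⟩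
    coefficient e (((p - q) * (p - q) + ((p * q + p * q) + (p * q + p * q))) * r)
      ≡⟨ two ((p - q) * (p - q)) ((p * q + p * q) + (p * q + p * q)) ⟩
    coefficient e ((p - q) * (p - q) * r) ℤ.+ coefficient e (((p * q + p * q) + (p * q + p * q)) * r)
      ≡⟨ cong (λ t → coefficient e ((p - q) * (p - q) * r) ℤ.+ t) (trans (two (p * q + p * q) (p * q + p * q))
           (cong₂ ℤ._+_ (two (p * q) (p * q)) (two (p * q) (p * q)))) ⟩
    coefficient e ((p - q) * (p - q) * r) ℤ.+ ((c ℤ.+ c) ℤ.+ (c ℤ.+ c)) ∎

-- The binomial theorem, read off at one coefficient of a multiple of (p + q)ⁿ.
coefficient-binomial : ∀ e p q n r →
  coefficient e ((p + q) ^ n * r) ≡ binomialSum n (λ k i → coefficient e (p ^ k * q ^ i * r))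
coefficient-binomial e p q zero    r =
  coefficient-cong e (*-congʳ {r} {1#} {1# * 1#} (≋-sym (*-identityˡ 1#)))
coefficient-binomial e p q (suc n) r = begin
  coefficient e ((p + q) * (p + q) ^ n * r)
    ≡⟨ coefficient-cong e (solve 4 (λ p q u r → (p :+ q) :* u :* r := u :* (p :* r) :+ u :* (q :* r))
         ≋-refl p q ((p + q) ^ n) r) ⟩
  coefficient e ((p + q) ^ n * (p * r) + (p + q) ^ n * (q * r))
    ≡⟨ coefficient-+ e ((p + q) ^ n * (p * r)) ((p + q) ^ n * (q * r)) ⟩
  coefficient e ((p + q) ^ n * (p * r)) ℤ.+ coefficient e ((p + q) ^ n * (q * r))
    ≡⟨ cong₂ ℤ._+_
         (trans (coefficient-binomial e p q n (p * r)) (binomialSum-cong n λ k i _ → coefficient-cong e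
            (solve 4 (λ u v p r → u :* v :* (p :* r) := p :* u :* v :* r) ≋-refl (p ^ k) (q ^ i) p r)))
         (trans (coefficient-binomial e p q n (q * r)) (binomialSum-cong n λ k i _ → coefficient-cong e
            (solve 4 (λ u v q r → u :* v :* (q :* r) := u :* (q :* v) :* r) ≋-refl (p ^ k) (q ^ i) q r))) ⟩
  binomialSum (suc n) (λ k i → coefficient e (p ^ k * q ^ i * r)) ∎
  where open ≡-Reasoning

coefficient-neg-^ : ∀ e p n r → coefficient e ((- p) ^ n * r) ≡ -1ℤ ℤ.^ n ℤ.* coefficient e (p ^ n * r)
coefficient-neg-^ e p zero    r = sym (ℤₚ.*-identityˡ (coefficient e (1# * r)))
coefficient-neg-^ e p (suc n) r = begin
  coefficient e (- p * (- p) ^ n * r)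
    ≡⟨ coefficient-cong e (solve 3 (λ m u r → m :* u :* r := u :* (m :* r)) ≋-refl (- p) ((- p) ^ n) r) ⟩
  coefficient e ((- p) ^ n * (- p * r))
    ≡⟨ coefficient-neg-^ e p n (- p * r) ⟩
  -1ℤ ℤ.^ n ℤ.* coefficient e (p ^ n * (- p * r))
    ≡⟨ cong (-1ℤ ℤ.^ n ℤ.*_) (trans (coefficient-cong e
         (≋-trans (solve 3 (λ u m r → u :* (m :* r) := m :* (u :* r)) ≋-refl (p ^ n) (- p) r)
           (≋-sym (-‿distribˡ-* p (p ^ n * r)))))
         (coefficient-neg e (p * (p ^ n * r)))) ⟩
  -1ℤ ℤ.^ n ℤ.* ℤ.- coefficient e (p * (p ^ n * r))
    ≡⟨ ring₁ (-1ℤ ℤ.^ n) (coefficient e (p * (p ^ n * r))) ⟩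
  -1ℤ ℤ.* -1ℤ ℤ.^ n ℤ.* coefficient e (p * (p ^ n * r))
    ≡⟨ cong (-1ℤ ℤ.^ suc n ℤ.*_) (coefficient-cong e (≋-sym (*-assoc p (p ^ n) r))) ⟩
  -1ℤ ℤ.* -1ℤ ℤ.^ n ℤ.* coefficient e (p * p ^ n * r) ∎
  where
  open ≡-Reasoning
  ring₁ : ∀ s u → s ℤ.* (ℤ.- u) ≡ ℤ.- 1ℤ ℤ.* s ℤ.* u
  ring₁ = solve-∀

-- Gradings

-- A grading of monomials by integers, additive under multiplication.
module Graded (deg : Monomial 3 → ℤ)
              (deg-+ : ∀ d d′ → deg (zipWith ℕ._+_ d d′) ≡ deg d ℤ.+ deg d′) where

  -- Every term of the list has degree w, including terms with coefficient 0.
  Homogeneous : ℤ → Polynomial 3 → Set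
  Homogeneous w = All (λ t → deg (proj₂ t) ≡ w)

  homogeneous-* : ∀ {v w p q} → Homogeneous v p → Homogeneous w q → Homogeneous (v ℤ.+ w) (p * q)
  homogeneous-* []              hq = []
  homogeneous-* {p = (c , d) ∷ p} (refl ∷ hp) hq = Allₚ.++⁺
    (Allₚ.map⁺ (All.map (λ { {_ , d′} refl → deg-+ d d′ }) hq)) (homogeneous-* hp hq)

  deg-1 : deg (replicate 3 0) ≡ 0ℤ
  deg-1 = begin
    deg (replicate 3 0) ≡⟨ ring₁ (deg (replicate 3 0)) ⟩
    (deg (replicate 3 0) ℤ.+ deg (replicate 3 0)) ℤ.- deg (replicate 3 0)
      ≡⟨ cong (ℤ._- deg (replicate 3 0)) (deg-+ (replicate 3 0) (replicate 3 0)) ⟨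
    deg (replicate 3 0) ℤ.- deg (replicate 3 0) ≡⟨ ℤₚ.+-inverseʳ (deg (replicate 3 0)) ⟩
    0ℤ ∎
    where
    open ≡-Reasoning
    ring₁ : ∀ u → u ≡ (u ℤ.+ u) ℤ.- u
    ring₁ = solve-∀

  homogeneous-^ : ∀ {w p} n → Homogeneous w p → Homogeneous (+ n ℤ.* w) (p ^ n)
  homogeneous-^ {w} zero    hp = trans deg-1 (sym (ℤₚ.*-zeroˡ w)) ∷ []
  homogeneous-^ {w} {p} (suc n) hp =
    subst (λ v → Homogeneous v (p ^ suc n)) (ring₁ (+ n) w) (homogeneous-* hp (homogeneous-^ n hp))
    where
    ring₁ : ∀ n w → w ℤ.+ n ℤ.* w ≡ (1ℤ ℤ.+ n) ℤ.* w
    ring₁ = solve-∀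

  coefficient-vanishes : ∀ {w p} e → Homogeneous w p → deg e ≢ w → coefficient e p ≡ 0ℤ
  coefficient-vanishes e []                      e≢w = refl
  coefficient-vanishes e (_∷_ {x = c , d} d≡w hp) e≢w with ≡-dec ℕₚ._≟_ d e
  ... | yes refl = ⊥-elim (e≢w d≡w)
  ... | no  _    = coefficient-vanishes e hp e≢w

z-degree : Monomial 3 → ℤ
z-degree (a ∷ b ∷ c ∷ []) = + c

z-degree-+ : ∀ d d′ → z-degree (zipWith ℕ._+_ d d′) ≡ z-degree d ℤ.+ z-degree d′
z-degree-+ (a ∷ b ∷ c ∷ []) (a′ ∷ b′ ∷ c′ ∷ []) = refl

-- The exponent of x minus the exponent of y.  Polynomials in xy are homogeneous of
-- degree 0 for it.
xy-imbalance : Monomial 3 → ℤ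
xy-imbalance (a ∷ b ∷ c ∷ []) = + a ℤ.- + b

xy-imbalance-+ : ∀ d d′ → xy-imbalance (zipWith ℕ._+_ d d′) ≡ xy-imbalance d ℤ.+ xy-imbalance d′
xy-imbalance-+ (a ∷ b ∷ c ∷ []) (a′ ∷ b′ ∷ c′ ∷ []) = ring₁ (+ a) (+ b) (+ a′) (+ b′)
  where
  ring₁ : ∀ a b a′ b′ → (a ℤ.+ a′) ℤ.- (b ℤ.+ b′) ≡ (a ℤ.- b) ℤ.+ (a′ ℤ.- b′)
  ring₁ = solve-∀

module Z-degree = Graded z-degree z-degree-+
module Imbalance = Graded xy-imbalance xy-imbalance-+

-- Coefficients of multiples of z and of xy

coefficient-z* : ∀ a b c p → coefficient (a ∷ b ∷ suc c ∷ []) (z * p) ≡ coefficient (a ∷ b ∷ c ∷ []) p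
coefficient-z* a b c [] = refl
coefficient-z* a b c ((u , d@(a′ ∷ b′ ∷ c′ ∷ [])) ∷ p) with does (≡-dec ℕₚ._≟_ d (a ∷ b ∷ c ∷ []))
... | true  = cong₂ ℤ._+_ (ℤₚ.*-identityˡ u) (coefficient-z* a b c p)
... | false = coefficient-z* a b c p

coefficient-z^* : ∀ a b m p → coefficient (a ∷ b ∷ m ∷ []) (z ^ m * p) ≡ coefficient (a ∷ b ∷ 0 ∷ []) p
coefficient-z^* a b zero    p = coefficient-cong (a ∷ b ∷ 0 ∷ []) (*-identityˡ p)
coefficient-z^* a b (suc m) p = begin
  coefficient (a ∷ b ∷ suc m ∷ []) (z * z ^ m * p)
    ≡⟨ coefficient-cong (a ∷ b ∷ suc m ∷ []) (*-assoc z (z ^ m) p) ⟩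
  coefficient (a ∷ b ∷ suc m ∷ []) (z * (z ^ m * p)) ≡⟨ coefficient-z* a b m (z ^ m * p) ⟩
  coefficient (a ∷ b ∷ m ∷ []) (z ^ m * p) ≡⟨ coefficient-z^* a b m p ⟩
  coefficient (a ∷ b ∷ 0 ∷ []) p ∎
  where open ≡-Reasoning

-- The monomial (xy)ᵉ.
diagonal : ℕ → Monomial 3
diagonal e = e ∷ e ∷ 0 ∷ []

coefficient-xy*-suc : ∀ e p → coefficient (diagonal (suc e)) (x * y * p) ≡ coefficient (diagonal e) p
coefficient-xy*-suc e [] = refl
coefficient-xy*-suc e ((u , d@(a′ ∷ b′ ∷ c′ ∷ [])) ∷ p) with does (≡-dec ℕₚ._≟_ d (diagonal e))
... | true  = cong₂ ℤ._+_ (ℤₚ.*-identityˡ u) (coefficient-xy*-suc e p)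
... | false = coefficient-xy*-suc e p

coefficient-xy*-zero : ∀ p → coefficient (diagonal 0) (x * y * p) ≡ 0ℤ
coefficient-xy*-zero []                              = refl
coefficient-xy*-zero ((u , (a′ ∷ b′ ∷ c′ ∷ [])) ∷ p) = coefficient-xy*-zero p

coefficient-xy^* : ∀ m e p → coefficient (diagonal (m ℕ.+ e)) ((x * y) ^ m * p) ≡ coefficient (diagonal e) p
coefficient-xy^* zero    e p = coefficient-cong (diagonal e) (*-identityˡ p)
coefficient-xy^* (suc m) e p = begin
  coefficient (diagonal (suc (m ℕ.+ e))) (x * y * (x * y) ^ m * p)
    ≡⟨ coefficient-cong (diagonal (suc (m ℕ.+ e))) (*-assoc (x * y) ((x * y) ^ m) p) ⟩
  coefficient (diagonal (suc (m ℕ.+ e))) (x * y * ((x * y) ^ m * p))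
    ≡⟨ coefficient-xy*-suc (m ℕ.+ e) ((x * y) ^ m * p) ⟩
  coefficient (diagonal (m ℕ.+ e)) ((x * y) ^ m * p)
    ≡⟨ coefficient-xy^* m e p ⟩
  coefficient (diagonal e) p ∎
  where open ≡-Reasoning

-- Coefficients of polynomials in xy

-- The summands of the three factors, which are s₊ + t₋, s₊ - t₋ and s₋ + t₊.
s₊ s₋ t₊ t₋ : Polynomial 3
s₊ = 1# + x * y
s₋ = 1# - x * y
t₊ = x * z + y * z
t₋ = x * z - y * z

coefficient-s₊^ : ∀ m e → coefficient (diagonal e) (s₊ ^ m) ≡ binom m e
coefficient-s₊^ zero    zero    = refl
coefficient-s₊^ zero    (suc e) = sym (binomial-zero {0} {suc e} (ℕ.s≤s ℕ.z≤n))
coefficient-s₊^ (suc m) e = begin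
  coefficient (diagonal e) (s₊ * s₊ ^ m)
    ≡⟨ coefficient-cong (diagonal e) (distribʳ (s₊ ^ m) 1# (x * y)) ⟩
  coefficient (diagonal e) (1# * s₊ ^ m + x * y * s₊ ^ m)
    ≡⟨ coefficient-+ (diagonal e) (1# * s₊ ^ m) (x * y * s₊ ^ m) ⟩
  coefficient (diagonal e) (1# * s₊ ^ m) ℤ.+ coefficient (diagonal e) (x * y * s₊ ^ m)
    ≡⟨ cong (ℤ._+ coefficient (diagonal e) (x * y * s₊ ^ m))
         (trans (coefficient-cong (diagonal e) (*-identityˡ (s₊ ^ m))) (coefficient-s₊^ m e)) ⟩
  binom m e ℤ.+ coefficient (diagonal e) (x * y * s₊ ^ m)
    ≡⟨ step e ⟩
  binom (suc m) e ∎
  where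
  open ≡-Reasoning
  step : ∀ e → binom m e ℤ.+ coefficient (diagonal e) (x * y * s₊ ^ m) ≡ binom (suc m) e
  step zero    = cong (λ t → 1ℤ ℤ.+ t) (coefficient-xy*-zero (s₊ ^ m))
  step (suc e) = begin
    binom m (suc e) ℤ.+ coefficient (diagonal (suc e)) (x * y * s₊ ^ m)
      ≡⟨ cong (λ t → binom m (suc e) ℤ.+ t) (trans (coefficient-xy*-suc e (s₊ ^ m)) (coefficient-s₊^ m e)) ⟩
    binom m (suc e) ℤ.+ binom m e
      ≡⟨ ℤₚ.+-comm (binom m (suc e)) (binom m e) ⟩
    binom m e ℤ.+ binom m (suc e)
      ≡⟨ binomial-pascal m e ⟨
    binom (suc m) (suc e) ∎

coefficient-s₊^xy^ : ∀ m e i → coefficient (diagonal e) (s₊ ^ m * (x * y) ^ i) ≡ shifted m e i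
coefficient-s₊^xy^ m e zero = trans
  (coefficient-cong (diagonal e) (≋-trans (*-comm (s₊ ^ m) 1#) (*-identityˡ (s₊ ^ m))))
  (coefficient-s₊^ m e)
coefficient-s₊^xy^ m e (suc i) = trans
  (coefficient-cong (diagonal e) (solve 3 (λ s c u → s :* (c :* u) := c :* (s :* u)) ≋-refl (s₊ ^ m) (x * y) ((x * y) ^ i)))
  (step e)
  where
  step : ∀ e → coefficient (diagonal e) (x * y * (s₊ ^ m * (x * y) ^ i)) ≡ shifted m e (suc i)
  step zero    = coefficient-xy*-zero (s₊ ^ m * (x * y) ^ i)
  step (suc e) = trans (coefficient-xy*-suc e (s₊ ^ m * (x * y) ^ i)) (coefficient-s₊^xy^ m e i)

-- The coefficient of cⁿ in (1 + c)²ᵏ (1 - c)²ʲ cⁱ, where c = xy.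
sCoefficient : ℕ → ℕ → ℕ → ℕ → ℤ
sCoefficient n k j i = coefficient (diagonal n) ((s₊ * s₊) ^ k * (s₋ * s₋) ^ j * (x * y) ^ i)

-- This is (1 - c)² = (1 + c)² - 4c.
sCoefficient-recurrence : ∀ n k j i → sCoefficient n k (suc j) i ≡ sCoefficient n (suc k) j i ℤ.+ -4ℤ ℤ.* sCoefficient n k j (suc i)
sCoefficient-recurrence n k j i = begin
  coefficient (diagonal n) (u * (s₋ * s₋ * v) * w)
    ≡⟨ coefficient-cong (diagonal n)
         (solve 4 (λ s u v w → u :* (s :* v) :* w := s :* (u :* v :* w)) ≋-refl (s₋ * s₋) u v w) ⟩
  coefficient (diagonal n) (s₋ * s₋ * (u * v * w))
    ≡⟨ coefficient-square-of-difference (diagonal n) 1# (x * y) (u * v * w) ⟩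
  coefficient (diagonal n) (s₊ * s₊ * (u * v * w)) ℤ.+ -4ℤ ℤ.* coefficient (diagonal n) (1# * (x * y) * (u * v * w))
    ≡⟨ cong₂ (λ s t → s ℤ.+ -4ℤ ℤ.* t)
         (coefficient-cong (diagonal n)
           (solve 4 (λ s u v w → s :* (u :* v :* w) := s :* u :* v :* w) ≋-refl (s₊ * s₊) u v w))
         (coefficient-cong (diagonal n) (≋-trans (*-congʳ {u * v * w} (*-identityˡ (x * y)))
           (solve 4 (λ c u v w → c :* (u :* v :* w) := u :* v :* (c :* w)) ≋-refl (x * y) u v w))) ⟩
  sCoefficient n (suc k) j i ℤ.+ -4ℤ ℤ.* sCoefficient n k j (suc i) ∎
  where
  open ≡-Reasoning
  u = (s₊ * s₊) ^ k
  v = (s₋ * s₋) ^ j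
  w = (x * y) ^ i

sCoefficient-base : ∀ n k i → sCoefficient n k 0 i ≡ shifted (2 *ℕ k) n i
sCoefficient-base n k i = trans
  (coefficient-cong (diagonal n) (*-congʳ {(x * y) ^ i}
    (≋-trans (*-comm ((s₊ * s₊) ^ k) 1#) (≋-trans (*-identityˡ ((s₊ * s₊) ^ k)) (square-^ s₊ k)))))
  (coefficient-s₊^xy^ (2 *ℕ k) n i)

-- The substitution (1 - c)² = (1 + c)² - 4c replaces powers of (1 - c)² by powers
-- of -4c, and all that remains are coefficients of powers of 1 + c.
sCoefficient-sum : ∀ n → binomialSum (2 *ℕ n) (λ k j → binom n j ℤ.* sCoefficient n k j 0) ≡ binom (2 *ℕ n) n ℤ.* binom (2 *ℕ n) n
sCoefficient-sum n = begin
  binomialSum (2 *ℕ n) (λ k j → binom n j ℤ.* sCoefficient n k j 0)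
    ≡⟨ binomialSum-cong (2 *ℕ n) (λ k j _ → cong₂ ℤ._*_ (sym (shiftedBinomial-diagonal n j)) (sym (ℤₚ.*-identityˡ (sCoefficient n k j 0)))) ⟩
  binomialSum (2 *ℕ n) (λ k j → shifted n n j ℤ.* (-4ℤ ℤ.^ 0 ℤ.* sCoefficient n k j 0))
    ≡⟨ binomialSum-transfer (2 *ℕ n) n n (λ k j i → -4ℤ ℤ.^ i ℤ.* sCoefficient n k j i) recurrence ⟩
  binomialSum (2 *ℕ n) (λ k i → shifted (k ℕ.+ n) n i ℤ.* (-4ℤ ℤ.^ i ℤ.* sCoefficient n k 0 i))
    ≡⟨ binomialSum-cong (2 *ℕ n) (λ k i _ → cong (λ t → shifted (k ℕ.+ n) n i ℤ.* (-4ℤ ℤ.^ i ℤ.* t)) (sCoefficient-base n k i)) ⟩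
  binomialSum (2 *ℕ n) (λ k i → shifted (k ℕ.+ n) n i ℤ.* (-4ℤ ℤ.^ i ℤ.* shifted (2 *ℕ k) n i))
    ≡⟨ binomialSum-evaluation n ⟩
  binom (2 *ℕ n) n ℤ.* binom (2 *ℕ n) n ∎
  where
  open ≡-Reasoning
  ring₁ : ∀ s u v → s ℤ.* (u ℤ.+ (ℤ.- + 4) ℤ.* v) ≡ s ℤ.* u ℤ.+ (ℤ.- + 4) ℤ.* s ℤ.* v
  ring₁ = solve-∀
  recurrence : ∀ k j i → -4ℤ ℤ.^ i ℤ.* sCoefficient n k (suc j) i ≡
    -4ℤ ℤ.^ i ℤ.* sCoefficient n (suc k) j i ℤ.+ -4ℤ ℤ.^ suc i ℤ.* sCoefficient n k j (suc i)
  recurrence k j i = trans (cong (-4ℤ ℤ.^ i ℤ.*_) (sCoefficient-recurrence n k j i)) (ring₁ (-4ℤ ℤ.^ i) (sCoefficient n (suc k) j i) (sCoefficient n k j (suc i)))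

-- Coefficients of forms in x and y

-- Of the expansion of (x + y)²ᵖ only the middle term can be balanced in x and y.
coefficient-central : ∀ e p F → Imbalance.Homogeneous 0ℤ F →
  coefficient (diagonal e) (((x + y) * (x + y)) ^ p * F) ≡
  binom (2 *ℕ p) p ℤ.* coefficient (diagonal e) ((x * y) ^ p * F)
coefficient-central e p F hF = begin
  coefficient (diagonal e) (((x + y) * (x + y)) ^ p * F)
    ≡⟨ coefficient-cong (diagonal e) (*-congʳ {F} (square-^ (x + y) p)) ⟩
  coefficient (diagonal e) ((x + y) ^ (2 *ℕ p) * F)
    ≡⟨ coefficient-binomial (diagonal e) x y (2 *ℕ p) F ⟩
  binomialSum (2 *ℕ p) (λ k i → coefficient (diagonal e) (x ^ k * y ^ i * F))
    ≡⟨ binomialSum-single (2 *ℕ p) p (λ k i → coefficient (diagonal e) (x ^ k * y ^ i * F)) vanish ⟩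
  binom (2 *ℕ p) p ℤ.* coefficient (diagonal e) (x ^ p * y ^ (2 *ℕ p ∸ p) * F)
    ≡⟨ cong (λ t → binom (2 *ℕ p) p ℤ.* coefficient (diagonal e) (x ^ p * y ^ t * F))
         (trans (cong (_∸ p) (2*n≡n+n p)) (ℕₚ.m+n∸m≡n p p)) ⟩
  binom (2 *ℕ p) p ℤ.* coefficient (diagonal e) (x ^ p * y ^ p * F)
    ≡⟨ cong (binom (2 *ℕ p) p ℤ.*_) (coefficient-cong (diagonal e) (*-congʳ {F} (≋-sym (^-distrib-* x y p)))) ⟩
  binom (2 *ℕ p) p ℤ.* coefficient (diagonal e) ((x * y) ^ p * F) ∎
  where
  open ≡-Reasoning
  open Imbalance
  ring₁ : ∀ k i → (k ℤ.* 1ℤ ℤ.+ i ℤ.* -1ℤ) ℤ.+ 0ℤ ≡ k ℤ.- i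
  ring₁ = solve-∀
  vanish : ∀ k i → k ℕ.+ i ≡ 2 *ℕ p → k ≢ p → coefficient (diagonal e) (x ^ k * y ^ i * F) ≡ 0ℤ
  vanish k i k+i≡2p k≢p = coefficient-vanishes (diagonal e)
    (homogeneous-* (homogeneous-* (homogeneous-^ k (refl ∷ [])) (homogeneous-^ i (refl ∷ []))) hF)
    λ eq → k≢p (k≡p (ℤₚ.+-injective (ℤₚ.i-j≡0⇒i≡j (+ k) (+ i)
      (trans (sym (ring₁ (+ k) (+ i))) (trans (sym eq) (ℤₚ.+-inverseʳ (+ e)))))))
    where
    k≡p : k ≡ i → k ≡ p
    k≡p refl = ℕₚ.*-cancelˡ-≡ k p 2 (trans (2*n≡n+n k) k+i≡2p)

-- In the coefficient of a balanced monomial, the form (x + y)²ᵖ (x - y)²ᵠ may be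
-- replaced by its middle term.  The factor F is generalised so that the induction
-- on q can absorb a factor xy into it.
coefficient-superCatalan : ∀ e p q F → Imbalance.Homogeneous 0ℤ F →
  coefficient (diagonal e) (((x + y) * (x + y)) ^ p * ((x - y) * (x - y)) ^ q * F) ≡
  superCatalan p q ℤ.* coefficient (diagonal e) ((x * y) ^ (p ℕ.+ q) * F)
coefficient-superCatalan e p zero    F hF = begin
  coefficient (diagonal e) (((x + y) * (x + y)) ^ p * 1# * F)
    ≡⟨ coefficient-cong (diagonal e) (*-congʳ {F} (≋-trans (*-comm (((x + y) * (x + y)) ^ p) 1#) (*-identityˡ _))) ⟩
  coefficient (diagonal e) (((x + y) * (x + y)) ^ p * F)
    ≡⟨ coefficient-central e p F hF ⟩
  binom (2 *ℕ p) p ℤ.* coefficient (diagonal e) ((x * y) ^ p * F)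
    ≡⟨ cong (λ t → binom (2 *ℕ p) p ℤ.* coefficient (diagonal e) ((x * y) ^ t * F)) (ℕₚ.+-identityʳ p) ⟨
  superCatalan p 0 ℤ.* coefficient (diagonal e) ((x * y) ^ (p ℕ.+ 0) * F) ∎
  where open ≡-Reasoning
coefficient-superCatalan e p (suc q) F hF = begin
  coefficient (diagonal e) (u * ((x - y) * (x - y) * v) * F)
    ≡⟨ coefficient-cong (diagonal e)
         (solve 4 (λ d u v F → u :* (d :* v) :* F := d :* (u :* v :* F)) ≋-refl ((x - y) * (x - y)) u v F) ⟩
  coefficient (diagonal e) ((x - y) * (x - y) * (u * v * F))
    ≡⟨ coefficient-square-of-difference (diagonal e) x y (u * v * F) ⟩
  coefficient (diagonal e) ((x + y) * (x + y) * (u * v * F)) ℤ.+ -4ℤ ℤ.* coefficient (diagonal e) (x * y * (u * v * F))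
    ≡⟨ cong₂ (λ s t → s ℤ.+ -4ℤ ℤ.* t)
         (trans (coefficient-cong (diagonal e)
             (solve 4 (λ d u v F → d :* (u :* v :* F) := d :* u :* v :* F) ≋-refl ((x + y) * (x + y)) u v F))
           (coefficient-superCatalan e (suc p) q F hF))
         (trans (coefficient-cong (diagonal e)
             (solve 4 (λ c u v F → c :* (u :* v :* F) := u :* v :* (c :* F)) ≋-refl (x * y) u v F))
           (trans (coefficient-superCatalan e p q (x * y * F) (Imbalance.homogeneous-* {p = x * y} (refl ∷ []) hF))
             (cong (superCatalan p q ℤ.*_) (coefficient-cong (diagonal e)
               (solve 3 (λ c w F → w :* (c :* F) := c :* w :* F) ≋-refl (x * y) ((x * y) ^ (p ℕ.+ q)) F))))) ⟩
  superCatalan (suc p) q ℤ.* c ℤ.+ -4ℤ ℤ.* (superCatalan p q ℤ.* c)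
    ≡⟨ ring₁ (superCatalan (suc p) q) (superCatalan p q) c ⟩
  superCatalan p (suc q) ℤ.* coefficient (diagonal e) ((x * y) ^ (suc (p ℕ.+ q)) * F)
    ≡⟨ cong (λ t → superCatalan p (suc q) ℤ.* coefficient (diagonal e) ((x * y) ^ t * F)) (ℕₚ.+-suc p q) ⟨
  superCatalan p (suc q) ℤ.* coefficient (diagonal e) ((x * y) ^ (p ℕ.+ suc q) * F) ∎
  where
  open ≡-Reasoning
  u = ((x + y) * (x + y)) ^ p
  v = ((x - y) * (x - y)) ^ q
  c = coefficient (diagonal e) ((x * y) ^ (suc (p ℕ.+ q)) * F)
  ring₁ : ∀ a b c → a ℤ.* c ℤ.+ (ℤ.- + 4) ℤ.* (b ℤ.* c) ≡ (a ℤ.- + 4 ℤ.* b) ℤ.* c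
  ring₁ = solve-∀

-1^-square : ∀ j → -1ℤ ℤ.^ j ℤ.* -1ℤ ℤ.^ j ≡ 1ℤ
-1^-square zero    = refl
-1^-square (suc j) = trans (ring₁ (-1ℤ ℤ.^ j)) (-1^-square j)
  where
  ring₁ : ∀ s → -1ℤ ℤ.* s ℤ.* (-1ℤ ℤ.* s) ≡ s ℤ.* s
  ring₁ = solve-∀

binomial-superCatalan : ∀ p j → let n = p ℕ.+ j in
  binom (2 *ℕ n) (2 *ℕ j) ℤ.* (-1ℤ ℤ.^ j ℤ.* superCatalan p j) ≡ binom (2 *ℕ n) n ℤ.* binom n j
binomial-superCatalan p j = ℤₚ.*-cancelʳ-≡ _ _ D {{D≢0}} (begin
  binom (2 *ℕ n) (2 *ℕ j) ℤ.* (s ℤ.* superCatalan p j) ℤ.* D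
    ≡⟨ ring₁ (binom (2 *ℕ n) (2 *ℕ j)) s (superCatalan p j) D ⟩
  binom (2 *ℕ n) (2 *ℕ j) ℤ.* s ℤ.* (superCatalan p j ℤ.* D)
    ≡⟨ cong (binom (2 *ℕ n) (2 *ℕ j) ℤ.* s ℤ.*_) (superCatalan-factorial p j) ⟩
  binom (2 *ℕ n) (2 *ℕ j) ℤ.* s ℤ.* (s ℤ.* (fact (2 *ℕ p) ℤ.* fact (2 *ℕ j)))
    ≡⟨ ring₂ (binom (2 *ℕ n) (2 *ℕ j)) s (fact (2 *ℕ p)) (fact (2 *ℕ j)) ⟩
  s ℤ.* s ℤ.* (binom (2 *ℕ n) (2 *ℕ j) ℤ.* (fact (2 *ℕ j) ℤ.* fact (2 *ℕ p)))
    ≡⟨ cong₂ ℤ._*_ (-1^-square j) (subst (λ t → binom t (2 *ℕ j) ℤ.* (fact (2 *ℕ j) ℤ.* fact (2 *ℕ p)) ≡ fact t)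
         (trans (sym (ℕₚ.*-distribˡ-+ 2 j p)) (cong (2 *ℕ_) (ℕₚ.+-comm j p))) (binomial-factorial (2 *ℕ j) (2 *ℕ p))) ⟩
  1ℤ ℤ.* fact (2 *ℕ n)
    ≡⟨ ℤₚ.*-identityˡ (fact (2 *ℕ n)) ⟩
  fact (2 *ℕ n)
    ≡⟨ central-binomial-factorial n ⟨
  binom (2 *ℕ n) n ℤ.* (fact n ℤ.* fact n)
    ≡⟨ cong (λ t → binom (2 *ℕ n) n ℤ.* (t ℤ.* fact n))
         (subst (λ t → binom t j ℤ.* (fact j ℤ.* fact p) ≡ fact t) (ℕₚ.+-comm j p) (binomial-factorial j p)) ⟨
  binom (2 *ℕ n) n ℤ.* (binom n j ℤ.* (fact j ℤ.* fact p) ℤ.* fact n)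
    ≡⟨ ring₃ (binom (2 *ℕ n) n) (binom n j) (fact j) (fact p) (fact n) ⟩
  binom (2 *ℕ n) n ℤ.* binom n j ℤ.* D ∎)
  where
  open ≡-Reasoning
  n = p ℕ.+ j
  s = -1ℤ ℤ.^ j
  D = fact p ℤ.* (fact j ℤ.* fact n)
  D≢0 : ℤ.NonZero D
  D≢0 = ℤₚ.i*j≢0 (fact p) (fact j ℤ.* fact n) {{p ℕₚ.!≢0}} {{ℤₚ.i*j≢0 (fact j) (fact n) {{j ℕₚ.!≢0}} {{n ℕₚ.!≢0}}}}
  ring₁ : ∀ b s m d → b ℤ.* (s ℤ.* m) ℤ.* d ≡ b ℤ.* s ℤ.* (m ℤ.* d)
  ring₁ = solve-∀
  ring₂ : ∀ b s u v → b ℤ.* s ℤ.* (s ℤ.* (u ℤ.* v)) ≡ s ℤ.* s ℤ.* (b ℤ.* (v ℤ.* u))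
  ring₂ = solve-∀
  ring₃ : ∀ a b u v w → a ℤ.* (b ℤ.* (u ℤ.* v) ℤ.* w) ≡ a ℤ.* b ℤ.* (v ℤ.* (u ℤ.* w))
  ring₃ = solve-∀

-- The expansion of the product

t₊-square : t₊ * t₊ ≋ (z * z) * ((x + y) * (x + y))
t₊-square = solve 3 (λ x y z → (x :* z :+ y :* z) :* (x :* z :+ y :* z) := (z :* z) :* ((x :+ y) :* (x :+ y))) ≋-refl x y z

-- x * z - y * z and (x - y) * z compute to the same list of terms.
t₋-square : t₋ * t₋ ≋ (z * z) * ((x - y) * (x - y))
t₋-square = solve 2 (λ d z → (d :* z) :* (d :* z) := (z :* z) :* (d :* d)) ≋-refl (x - y) z

-- The contribution of s₊²ᵏ (-t₋²)ʲ from (s₊² - t₋²)²ⁿ, without its binomial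
-- coefficient.
expansionTerm : ℕ → ℕ → ℕ → ℤ
expansionTerm n k j = coefficient (replicate 3 (2 *ℕ n))
  ((s₊ * s₊) ^ k * (- (t₋ * t₋)) ^ j * (s₋ + t₊) ^ (2 *ℕ n))

-- By z-degree, only the power s₋²ʲ of s₋ can contribute; when 2j > 2n there is no
-- such term, the binomial coefficient is 0 and the truncated exponent of t₊ is
-- irrelevant.
expansionTerm-select : ∀ n k j → expansionTerm n k j ≡ binom (2 *ℕ n) (2 *ℕ j) ℤ.*
  coefficient (replicate 3 (2 *ℕ n))
    (s₋ ^ (2 *ℕ j) * t₊ ^ (2 *ℕ n ∸ 2 *ℕ j) * ((s₊ * s₊) ^ k * (- (t₋ * t₋)) ^ j))
expansionTerm-select n k j = begin
  coefficient e (F * (s₋ + t₊) ^ N)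
    ≡⟨ coefficient-cong e (*-comm F ((s₋ + t₊) ^ N)) ⟩
  coefficient e ((s₋ + t₊) ^ N * F)
    ≡⟨ coefficient-binomial e s₋ t₊ N F ⟩
  binomialSum N (λ l i → coefficient e (s₋ ^ l * t₊ ^ i * F))
    ≡⟨ binomialSum-single N (2 *ℕ j) (λ l i → coefficient e (s₋ ^ l * t₊ ^ i * F)) vanish ⟩
  binom N (2 *ℕ j) ℤ.* coefficient e (s₋ ^ (2 *ℕ j) * t₊ ^ (N ∸ 2 *ℕ j) * F) ∎
  where
  open ≡-Reasoning
  open Z-degree
  N = 2 *ℕ n
  e = replicate 3 N
  F = (s₊ * s₊) ^ k * (- (t₋ * t₋)) ^ j
  ring₁ : ∀ l i k j → (l ℤ.* 0ℤ ℤ.+ i ℤ.* 1ℤ) ℤ.+ (k ℤ.* 0ℤ ℤ.+ j ℤ.* + 2) ≡ i ℤ.+ + 2 ℤ.* j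
  ring₁ = solve-∀
  hF : Homogeneous (+ k ℤ.* 0ℤ ℤ.+ + j ℤ.* + 2) F
  hF = homogeneous-* (homogeneous-^ k (refl ∷ refl ∷ refl ∷ refl ∷ []))
                     (homogeneous-^ j (refl ∷ refl ∷ refl ∷ refl ∷ []))
  vanish : ∀ l i → l ℕ.+ i ≡ N → l ≢ 2 *ℕ j → coefficient e (s₋ ^ l * t₊ ^ i * F) ≡ 0ℤ
  vanish l i l+i≡N l≢2j = coefficient-vanishes e
    (homogeneous-* (homogeneous-* (homogeneous-^ l (refl ∷ refl ∷ [])) (homogeneous-^ i (refl ∷ refl ∷ []))) hF)
    λ eq → l≢2j (ℕₚ.+-cancelˡ-≡ i l (2 *ℕ j) (trans (ℕₚ.+-comm i l) (trans l+i≡N (ℤₚ.+-injective (begin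
      + N ≡⟨ eq ⟩
      (+ l ℤ.* 0ℤ ℤ.+ + i ℤ.* 1ℤ) ℤ.+ (+ k ℤ.* 0ℤ ℤ.+ + j ℤ.* + 2) ≡⟨ ring₁ (+ l) (+ i) (+ k) (+ j) ⟩
      + i ℤ.+ + 2 ℤ.* + j ≡⟨ cong (λ t → + i ℤ.+ t) (ℤₚ.pos-* 2 j) ⟨
      + (i ℕ.+ 2 *ℕ j) ∎)))))

-- The case j ≤ n, with p = n - j.  The factors z² of t₊² and t₋² make up z²ⁿ; then
-- the forms in x and y give way to a super Catalan number times (xy)ⁿ.
expansionTerm-value-≤ : ∀ p j k → let n = p ℕ.+ j in
  expansionTerm n k j ≡ binom (2 *ℕ n) n ℤ.* (binom n j ℤ.* sCoefficient n k j 0)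
expansionTerm-value-≤ p j k = begin
  expansionTerm n k j
    ≡⟨ expansionTerm-select n k j ⟩
  binom N (2 *ℕ j) ℤ.* coefficient e (s₋ ^ (2 *ℕ j) * t₊ ^ (N ∸ 2 *ℕ j) * ((s₊ * s₊) ^ k * (- (t₋ * t₋)) ^ j))
    ≡⟨ cong (λ t → binom N (2 *ℕ j) ℤ.* coefficient e (s₋ ^ (2 *ℕ j) * t₊ ^ t * ((s₊ * s₊) ^ k * (- (t₋ * t₋)) ^ j))) index ⟩
  binom N (2 *ℕ j) ℤ.* coefficient e (s₋ ^ (2 *ℕ j) * t₊ ^ (2 *ℕ p) * ((s₊ * s₊) ^ k * (- (t₋ * t₋)) ^ j))
    ≡⟨ cong (binom N (2 *ℕ j) ℤ.*_) (trans (coefficient-cong e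
         (solve 4 (λ a b c d → a :* b :* (c :* d) := d :* (a :* b :* c)) ≋-refl
           (s₋ ^ (2 *ℕ j)) (t₊ ^ (2 *ℕ p)) ((s₊ * s₊) ^ k) ((- (t₋ * t₋)) ^ j)))
         (coefficient-neg-^ e (t₋ * t₋) j (s₋ ^ (2 *ℕ j) * t₊ ^ (2 *ℕ p) * (s₊ * s₊) ^ k))) ⟩
  binom N (2 *ℕ j) ℤ.* (-1ℤ ℤ.^ j ℤ.* coefficient e ((t₋ * t₋) ^ j * (s₋ ^ (2 *ℕ j) * t₊ ^ (2 *ℕ p) * (s₊ * s₊) ^ k)))
    ≡⟨ cong (λ t → binom N (2 *ℕ j) ℤ.* (-1ℤ ℤ.^ j ℤ.* t)) value ⟩
  binom N (2 *ℕ j) ℤ.* (-1ℤ ℤ.^ j ℤ.* (superCatalan p j ℤ.* sCoefficient n k j 0))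
    ≡⟨ ring₁ (binom N (2 *ℕ j)) (-1ℤ ℤ.^ j) (superCatalan p j) (sCoefficient n k j 0) ⟩
  binom N (2 *ℕ j) ℤ.* (-1ℤ ℤ.^ j ℤ.* superCatalan p j) ℤ.* sCoefficient n k j 0
    ≡⟨ cong (ℤ._* sCoefficient n k j 0) (binomial-superCatalan p j) ⟩
  binom N n ℤ.* binom n j ℤ.* sCoefficient n k j 0
    ≡⟨ ℤₚ.*-assoc (binom N n) (binom n j) (sCoefficient n k j 0) ⟩
  binom N n ℤ.* (binom n j ℤ.* sCoefficient n k j 0) ∎
  where
  open ≡-Reasoning
  n = p ℕ.+ j
  N = 2 *ℕ n
  e = replicate 3 N
  ring₁ : ∀ b s m t → b ℤ.* (s ℤ.* (m ℤ.* t)) ≡ b ℤ.* (s ℤ.* m) ℤ.* t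
  ring₁ = solve-∀
  index : N ∸ 2 *ℕ j ≡ 2 *ℕ p
  index = trans (cong (_∸ 2 *ℕ j) (ℕₚ.*-distribˡ-+ 2 p j)) (ℕₚ.m+n∸n≡m (2 *ℕ p) (2 *ℕ j))
  F = (s₊ * s₊) ^ k * (s₋ * s₋) ^ j * 1#
  hF : Imbalance.Homogeneous 0ℤ F
  hF = subst (λ w → Imbalance.Homogeneous w F) (ring₂ (+ k) (+ j))
    (homogeneous-* (homogeneous-* (homogeneous-^ k (refl ∷ refl ∷ refl ∷ refl ∷ []))
                                  (homogeneous-^ j (refl ∷ refl ∷ refl ∷ refl ∷ []))) (refl ∷ []))
    where
    open Imbalance
    ring₂ : ∀ k j → (k ℤ.* 0ℤ ℤ.+ j ℤ.* 0ℤ) ℤ.+ 0ℤ ≡ 0ℤ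
    ring₂ = solve-∀
  Q = ((x + y) * (x + y)) ^ p
  Z = ((x - y) * (x - y)) ^ j
  regroup : (t₋ * t₋) ^ j * (s₋ ^ (2 *ℕ j) * t₊ ^ (2 *ℕ p) * (s₊ * s₊) ^ k) ≋ z ^ N * (Q * Z * F)
  regroup = R.begin
    (t₋ * t₋) ^ j * (s₋ ^ (2 *ℕ j) * t₊ ^ (2 *ℕ p) * (s₊ * s₊) ^ k)
      R.≈⟨ *-cong (≋-trans (^-congˡ j t₋-square) (^-distrib-* (z * z) ((x - y) * (x - y)) j))
           (*-congʳ {(s₊ * s₊) ^ k} (*-cong (≋-sym (square-^ s₋ j))
             (≋-trans (≋-sym (square-^ t₊ p))
               (≋-trans (^-congˡ p t₊-square) (^-distrib-* (z * z) ((x + y) * (x + y)) p))))) ⟩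
    ((z * z) ^ j * Z) * ((s₋ * s₋) ^ j * ((z * z) ^ p * Q) * (s₊ * s₊) ^ k)
      R.≈⟨ solve 6 (λ a Z c b Q d → (a :* Z) :* (c :* (b :* Q) :* d) := b :* a :* (Q :* Z :* (d :* c))) ≋-refl
             ((z * z) ^ j) Z ((s₋ * s₋) ^ j) ((z * z) ^ p) Q ((s₊ * s₊) ^ k) ⟩
    (z * z) ^ p * (z * z) ^ j * (Q * Z * ((s₊ * s₊) ^ k * (s₋ * s₋) ^ j))
      R.≈⟨ *-cong (≋-trans (≋-sym (^-homo-* (z * z) p j)) (square-^ z n))
             (*-congˡ {Q * Z} (≋-trans (≋-sym (*-identityˡ _)) (*-comm 1# ((s₊ * s₊) ^ k * (s₋ * s₋) ^ j)))) ⟩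
    z ^ N * (Q * Z * F) R.∎
    where module R = ≋-Reasoning
  value : coefficient e ((t₋ * t₋) ^ j * (s₋ ^ (2 *ℕ j) * t₊ ^ (2 *ℕ p) * (s₊ * s₊) ^ k)) ≡ superCatalan p j ℤ.* sCoefficient n k j 0
  value = begin
    coefficient e ((t₋ * t₋) ^ j * (s₋ ^ (2 *ℕ j) * t₊ ^ (2 *ℕ p) * (s₊ * s₊) ^ k))
      ≡⟨ coefficient-cong e regroup ⟩
    coefficient e (z ^ N * (Q * Z * F))
      ≡⟨ coefficient-z^* N N N (Q * Z * F) ⟩
    coefficient (diagonal N) (Q * Z * F)
      ≡⟨ coefficient-superCatalan N p j F hF ⟩
    superCatalan p j ℤ.* coefficient (diagonal N) ((x * y) ^ n * F)
      ≡⟨ cong (λ t → superCatalan p j ℤ.* coefficient (diagonal t) ((x * y) ^ n * F)) (2*n≡n+n n) ⟩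
    superCatalan p j ℤ.* coefficient (diagonal (n ℕ.+ n)) ((x * y) ^ n * F)
      ≡⟨ cong (superCatalan p j ℤ.*_) (coefficient-xy^* n n F) ⟩
    superCatalan p j ℤ.* sCoefficient n k j 0 ∎

expansionTerm-value : ∀ n k j → expansionTerm n k j ≡ binom (2 *ℕ n) n ℤ.* (binom n j ℤ.* sCoefficient n k j 0)
expansionTerm-value n k j with ℕₚ.≤-<-connex j n
... | inj₁ j≤n = subst (λ m → expansionTerm m k j ≡ binom (2 *ℕ m) m ℤ.* (binom m j ℤ.* sCoefficient m k j 0))
                   (ℕₚ.m∸n+n≡m j≤n) (expansionTerm-value-≤ (n ∸ j) j k)
... | inj₂ n<j = trans (expansionTerm-select n k j) (trans
  (*-zero-factor _ (binomial-zero (ℕₚ.*-monoʳ-< 2 n<j)))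
  (sym (trans (cong (binom (2 *ℕ n) n ℤ.*_) (*-zero-factor (sCoefficient n k j 0) (binomial-zero n<j))) (ℤₚ.*-zeroʳ (binom (2 *ℕ n) n)))))

theorem5p4 : ∀ (n : ℕ) →
    + (((2 *ℕ n) C n) ^ℕ 3) ≡
    [⟨xyz⟩^ 2 *ℕ n ]
    ((1# + x * y + x * z - y * z) ^ (2 *ℕ n)
    * (1# + x * y - x * z + y * z) ^ (2 *ℕ n)
    * (1# - x * y + x * z + y * z) ^ (2 *ℕ n))
theorem5p4 n = sym (begin
  -- The three factors and the sums below are closed and compute to the same lists.
  coefficient e ((s₊ + t₋) ^ N * (s₊ - t₋) ^ N * (s₋ + t₊) ^ N)
    ≡⟨ coefficient-cong e (*-congʳ {(s₋ + t₊) ^ N} (≋-trans (≋-sym (^-distrib-* (s₊ + t₋) (s₊ - t₋) N))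
         (^-congˡ N (difference-of-squares s₊ t₋)))) ⟩
  coefficient e ((s₊ * s₊ - t₋ * t₋) ^ N * (s₋ + t₊) ^ N)
    ≡⟨ coefficient-binomial e (s₊ * s₊) (- (t₋ * t₋)) N ((s₋ + t₊) ^ N) ⟩
  binomialSum N (expansionTerm n)
    ≡⟨ binomialSum-cong N (λ k j _ → expansionTerm-value n k j) ⟩
  binomialSum N (λ k j → binom N n ℤ.* (binom n j ℤ.* sCoefficient n k j 0))
    ≡⟨ binomialSum-*ˡ N (binom N n) (λ k j → binom n j ℤ.* sCoefficient n k j 0) ⟩
  binom N n ℤ.* binomialSum N (λ k j → binom n j ℤ.* sCoefficient n k j 0)
    ≡⟨ cong (binom N n ℤ.*_) (sCoefficient-sum n) ⟩
  binom N n ℤ.* (binom N n ℤ.* binom N n)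
    ≡⟨ cong (binom N n ℤ.*_) (ℤₚ.pos-* (N C n) (N C n)) ⟨
  binom N n ℤ.* + ((N C n) *ℕ (N C n))
    ≡⟨ ℤₚ.pos-* (N C n) ((N C n) *ℕ (N C n)) ⟨
  + ((N C n) *ℕ ((N C n) *ℕ (N C n)))
    ≡⟨ cong (λ t → + ((N C n) *ℕ ((N C n) *ℕ t))) (ℕₚ.*-identityʳ (N C n)) ⟨
  + ((N C n) ^ℕ 3) ∎)
  where
  open ≡-Reasoning
  N = 2 *ℕ n
  e = replicate 3 N
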